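{- A lattice simplex $\Delta$ is (isomorphic to) a free join $\Delta_1\circ_{\mathbb{Z}}\Delta_2$ of lattice simplices $\Delta_1$ and $\Delta_2$ if and only if the corresponding linear code $C_\Delta$ is (isomorphic to) the direct sum $C_{\Delta_1}\oplus C_{\Delta_2}$.
   Context: Let $M\cong\mathbb{Z}^d$ be a lattice and $\Delta$ a $d$-dimensional lattice simplex in $M\otimes\mathbb{R}$ with vertices $v_0,\dots,v_d\in M$. Lattice simplices are isomorphic if an affine unimodular transformation maps one to the other. The free join of lattice polytopes $\Delta_1,\Delta_2$ of dimensions $d_1,d_2$ is $\Delta_1\circ_{\mathbb{Z}}\Delta_2=\operatorname{conv}(\Delta_1\times\{0^{d_2}\}\times\{0\},\ \{0^{d_1}\}\times\Delta_2\times\{1\})\subset\mathbb{R}^{d_1+d_2+1}$. Code of a simplex: $\mathbb{Z}_N=\mathbb{Z}/N\mathbb{Z}$. Let $\Lambda_\Delta=\{x\in(\mathbb{R}/\mathbb{Z})^{d+1}:\sum_i\{x_i\}(v_i,1)\in M\oplus\mathbb{Z}\}$, where $\{\cdot\}$ is the fractional part. $N_\Delta$ is the least common multiple of the denominators of all coordinates of elements of $\Lambda_\Delta$, and $C_\Delta=\{(N_\Delta\{x_0\},\dots,N_\Delta\{x_d\}):x\in\Lambda_\Delta\}\subseteq\mathbb{Z}_{N_\Delta}^{d+1}$. Codes over the same $\mathbb{Z}_N$ and of the same length are isomorphic if they coincide after a permutation of coordinates. It is known that two lattice simplices are isomorphic if and only if their codes are. Direct sum: for codes $C_1$ over $\mathbb{Z}_{N_1}$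 and $C_2$ over $\mathbb{Z}_{N_2}$, with $L=\operatorname{lcm}(N_1,N_2)$, $C_1\oplus C_2$ is the code over $\mathbb{Z}_L$ consisting of all concatenations $\frac{L}{N_1}c_1\,|\,\frac{L}{N_2}c_2$, $c_1\in C_1$, $c_2\in C_2$.
   Formalization: Polytopes and free joins are taken as sets of rational points (convex hulls with rational weights), and the elements of the group Λ are taken with rational rather than real coordinates. -}

module Defs where

open import Algebra.Bundles using (CommutativeRing)
open import Data.Bool.Base using (if_then_else_)
open import Data.Empty using (⊥-elim)
open import Data.Fin.Base using (Fin; zero; suc; toℕ; fromℕ<; cast; finToFun; funToFin)
import Data.Fin.Properties as Fin
open import Data.Fin.Permutation using (Permutation; _⟨$⟩ˡ_)
open import Data.Integer.Base as ℤ using (ℤ; +_; -[1+_]; 0ℤ; 1ℤ)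
import Data.Integer.DivMod as ℤ
import Data.Integer.Properties as ℤ
open import Data.Nat.Base as ℕ using (ℕ; zero; suc; NonZero)
open import Data.Nat.Divisibility using (_∣_; ∣-trans; 1∣_)
open import Data.Nat.DivMod using (_/_; _mod_; m<n⇒m/n≡0)
open import Data.Nat.GCD using (gcd)
open import Data.Nat.LCM using (lcm; m∣lcm[m,n]; n∣lcm[m,n]; lcm-least; gcd*lcm)
import Data.Nat.Properties as ℕ
open import Data.Product.Base using (∃-syntax; Σ-syntax; _×_; _,_; proj₁; proj₂)
open import Data.Rational.Base as ℚ using (ℚ; 0ℚ; 1ℚ; floor; _+_; _*_; _-_; -_; ↥_; ↧_; ↧ₙ_)
open import Data.Rational.Literals using (fromℤ)
import Data.Rational.Properties as ℚ
import Data.Rational.Solver as ℚSolver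
import Data.Rational.Unnormalised.Base as ℚᵘ
import Data.Rational.Unnormalised.Properties as ℚᵘ
open import Data.Sum.Base using (inj₁; inj₂)
open import Data.Unit.Base using (⊤; tt)
open import Data.Vec.Functional using (Vector; _∷_; _++_; replicate)
open import Function.Base using (_∘_)
open import Function.Bundles using (_⇔_)
open import Level using (0ℓ)
open import Relation.Binary.PropositionalEquality
open import Relation.Nullary using (yes; no; ¬?; does; contradiction)
open import Relation.Nullary.Decidable using (_×-dec_; map′; decidable-stable)
open import Relation.Unary using (Pred; Decidable; _∪_)

import Algebra.Properties.Semiring.Sum
  (CommutativeRing.semiring ℚ.+-*-commutativeRing) as ℚ-Sum
import Algebra.Properties.Semiring.Sum
  (CommutativeRing.semiring ℤ.+-*-commutativeRing) as ℤ-Sum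

open ℚ-Sum public using (sum; sum-syntax)

-- Real coordinates are replaced by rational ones throughout: a lattice simplex
-- is determined by its rational points, and a real relation
-- Σ xᵢ (vᵢ , 1) ∈ ℤᵈ ⊕ ℤ forces the xᵢ to be rational because the vᵢ are
-- affinely independent integer vectors.
Point : ℕ → Set
Point d = Vector ℚ d

LatticePoint : ℕ → Set
LatticePoint d = Vector ℤ d

-- Sets of points are predicates; vectors are functions, so a point is only ever
-- compared pointwise (_≗_).
ConvexHull : ∀ {d} → Pred (Point d) 0ℓ → Pred (Point d) 0ℓ
ConvexHull {d} S x =
  ∃[ n ] Σ[ p ∈ Vector (Point d) n ] Σ[ λs ∈ Vector ℚ n ]
    (∀ k → S (p k)) ×
    (∀ k → 0ℚ ℚ.≤ λs k) ×
    sum λs ≡ 1ℚ ×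
    (∀ j → x j ≡ ∑[ k < n ] (λs k * p k j))

FreeJoin : ∀ {d₁ d₂} → Pred (Point d₁) 0ℓ → Pred (Point d₂) 0ℓ →
           Pred (Point (d₁ ℕ.+ d₂ ℕ.+ 1)) 0ℓ
FreeJoin {d₁} {d₂} P Q = ConvexHull (bottom ∪ top)
  where
  bottom top : Pred (Point (d₁ ℕ.+ d₂ ℕ.+ 1)) 0ℓ
  bottom z = ∃[ p ] P p × z ≗ ((p ++ replicate d₂ 0ℚ) ++ replicate 1 0ℚ)
  top    z = ∃[ q ] Q q × z ≗ ((replicate d₁ 0ℚ ++ q) ++ replicate 1 1ℚ)

identityMatrix : ∀ {d} → Fin d → Fin d → ℤ
identityMatrix i j = if does (i Fin.≟ j) then 1ℤ else 0ℤ

-- x ↦ A x + b with A invertible over ℤ. For d = e this is A ∈ GL_d(ℤ); for d ≢ e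
-- there is no such A.
record AffineUnimodular (d e : ℕ) : Set where
  field
    matrix      : Fin e → Fin d → ℤ
    inverse     : Fin d → Fin e → ℤ
    translation : LatticePoint e
    inverseˡ    : ∀ i j → ℤ-Sum.sum (λ k → inverse i k ℤ.* matrix k j) ≡ identityMatrix i j
    inverseʳ    : ∀ i j → ℤ-Sum.sum (λ k → matrix i k ℤ.* inverse k j) ≡ identityMatrix i j

  apply : Point d → Point e
  apply x i = (∑[ j < d ] (fromℤ (matrix i j) * x j)) + fromℤ (translation i)

infix 4 _≅ᴾ_

_≅ᴾ_ : ∀ {d e} → Pred (Point d) 0ℓ → Pred (Point e) 0ℓ → Set
_≅ᴾ_ {d} {e} P Q =
  Σ[ φ ∈ AffineUnimodular d e ]
    (∀ y → Q y ⇔ (∃[ x ] P x × y ≗ AffineUnimodular.apply φ x))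

AffinelyIndependent : ∀ {d n} → Vector (LatticePoint d) n → Set
AffinelyIndependent {d} {n} v =
  (a : Vector ℚ n) →
  sum a ≡ 0ℚ →
  (∀ j → ∑[ i < n ] (a i * fromℤ (v i j)) ≡ 0ℚ) →
  ∀ i → a i ≡ 0ℚ

record LatticeSimplex (d : ℕ) : Set where
  field
    vertex              : Vector (LatticePoint d) (suc d)
    affinelyIndependent : AffinelyIndependent vertex

  polytope : Pred (Point d) 0ℓ
  polytope = ConvexHull (λ p → ∃[ i ] p ≗ fromℤ ∘ vertex i)

open LatticeSimplex public using (polytope)

IsInteger : Pred ℚ 0ℓ
IsInteger q = ∃[ z ] q ≡ fromℤ z

-- Not the library's fracPart, which is ∣ q - truncate q ∣ and so sends -¼ to ¼.
frac : ℚ → ℚ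
frac q = q - fromℤ (floor q)

-- Elements of (ℝ/ℤ)ᵈ⁺¹ are given by representatives x in ℚᵈ⁺¹, on which
-- everything below depends only through frac ∘ x.
Λ : ∀ {d} → LatticeSimplex d → Pred (Vector ℚ (suc d)) 0ℓ
Λ {d} Δ x =
  (∀ j → IsInteger (∑[ i ≤ d ] (frac (x i) * fromℤ (vertex i j)))) ×
  IsInteger (∑[ i ≤ d ] frac (x i))
  where open LatticeSimplex Δ
        open ℚ-Sum using (sum⁺-syntax)

Denominators : ∀ {d} → LatticeSimplex d → Pred ℕ 0ℓ
Denominators Δ n = ∃[ x ] Λ Δ x × ∃[ i ] n ≡ ↧ₙ (frac (x i))

record IsLCMOf (S : Pred ℕ 0ℓ) (L : ℕ) : Set where
  field
    multiple : ∀ {n} → S n → n ∣ L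
    least    : ∀ {m} → (∀ {n} → S n → n ∣ m) → L ∣ m

-- Λ Δ has infinitely many representatives but only finitely many classes. Fraction-free
-- elimination on the vectors (1 , vᵢ) yields a D with D · frac xᵢ ∈ ℤ for all x in Λ Δ, so
-- the denominators all occur on the finite grid {0, 1/D, …, (D-1)/D}ᵈ⁺¹.
lcm-nonZero : ∀ m n .{{_ : NonZero m}} .{{_ : NonZero n}} → NonZero (lcm m n)
lcm-nonZero m n = ℕ.≢-nonZero λ eq →
  ℕ.≢-nonZero⁻¹ (m ℕ.* n) {{ℕ.m*n≢0 m n}}
    (trans (sym (gcd*lcm m n)) (trans (cong (gcd m n ℕ.*_) eq) (ℕ.*-zeroʳ (gcd m n))))

lcmFamily : ∀ {n} (f : Fin n → ℕ) → (∀ i → NonZero (f i)) →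
  {P : Pred (Fin n) 0ℓ} → Decidable P →
  Σ[ L ∈ ℕ ] NonZero L × IsLCMOf (λ m → ∃[ i ] P i × m ≡ f i) L
lcmFamily {zero} f nz P? = 1 , _ , record { multiple = λ () ; least = λ _ → 1∣ _ }
lcmFamily {suc n} f nz P? with P? zero | lcmFamily (f ∘ suc) (nz ∘ suc) (P? ∘ suc)
... | yes p | L , L≢0 , isL = lcm (f zero) L , lcm-nonZero _ _ {{nz zero}} {{L≢0}} , record
  { multiple = λ where
      (zero  , _ , refl) → m∣lcm[m,n] _ _
      (suc i , q , eq)   → ∣-trans (IsLCMOf.multiple isL (i , q , eq)) (n∣lcm[m,n] (f zero) L)
  ; least = λ h → lcm-least (h (zero , p , refl))
                            (IsLCMOf.least isL λ (i , q , eq) → h (suc i , q , eq))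
  }
... | no ¬p | L , L≢0 , isL = L , L≢0 , record
  { multiple = λ where
      (zero  , q , _)  → ⊥-elim (¬p q)
      (suc i , q , eq) → IsLCMOf.multiple isL (i , q , eq)
  ; least = λ h → IsLCMOf.least isL λ (i , q , eq) → h (suc i , q , eq)
  }

fromℤ-injective : ∀ {a b} → fromℤ a ≡ fromℤ b → a ≡ b
fromℤ-injective = cong ↥_

fromℤ-+ : ∀ a b → fromℤ (a ℤ.+ b) ≡ fromℤ a + fromℤ b
fromℤ-+ a b = ℚ.toℚᵘ-injective (ℚᵘ.≃-sym (ℚᵘ.≃-trans
  (ℚ.toℚᵘ-homo-+ (fromℤ a) (fromℤ b))
  (ℚᵘ.*≡* (cong (ℤ._* 1ℤ) (cong₂ ℤ._+_ (ℤ.*-identityʳ a) (ℤ.*-identityʳ b))))))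

fromℤ-* : ∀ a b → fromℤ (a ℤ.* b) ≡ fromℤ a * fromℤ b
fromℤ-* a b = ℚ.toℚᵘ-injective (ℚᵘ.≃-sym (ℚ.toℚᵘ-homo-* (fromℤ a) (fromℤ b)))

fromℤ-neg : ∀ a → fromℤ (ℤ.- a) ≡ - fromℤ a
fromℤ-neg (+ zero)  = refl
fromℤ-neg (+ suc n) = refl
fromℤ-neg -[1+ n ]  = refl

int-+ : ∀ {p q} → IsInteger p → IsInteger q → IsInteger (p + q)
int-+ (a , refl) (b , refl) = a ℤ.+ b , sym (fromℤ-+ a b)

int-* : ∀ {p q} → IsInteger p → IsInteger q → IsInteger (p * q)
int-* (a , refl) (b , refl) = a ℤ.* b , sym (fromℤ-* a b)

int-neg : ∀ {p} → IsInteger p → IsInteger (- p)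
int-neg (a , refl) = ℤ.- a , sym (fromℤ-neg a)

int-sum : ∀ {n} (f : Vector ℚ n) → (∀ i → IsInteger (f i)) → IsInteger (sum f)
int-sum {zero}  f h = 0ℤ , refl
int-sum {suc n} f h = int-+ (h zero) (int-sum (f ∘ suc) (h ∘ suc))

isInteger? : Decidable IsInteger
isInteger? q = map′ (λ eq → ↥ q , eq) (λ { (z , refl) → refl }) (q ℚ.≟ fromℤ (↥ q))

Independent : ∀ {m n} → (Fin m → Fin n → ℤ) → Set
Independent {m} w = (a : Vector ℚ m) →
  (∀ l → ∑[ i < m ] (a i * fromℤ (w i l)) ≡ 0ℚ) → ∀ i → a i ≡ 0ℚ

sum-zero : ∀ {n} (f : Vector ℚ n) → (∀ i → f i ≡ 0ℚ) → sum f ≡ 0ℚ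
sum-zero {n} f h = trans (ℚ-Sum.sum-cong-≗ h) (ℚ-Sum.sum-replicate-zero n)

module Elimination {m n} (w : Fin (suc m) → Fin n → ℤ) (j : Fin n) where
  p : ℤ
  p = w zero j

  w′ : Fin m → Fin n → ℤ
  w′ i l = p ℤ.* w (suc i) l ℤ.- w (suc i) j ℤ.* w zero l

  S : Vector ℚ m → Fin n → ℚ
  S b l = ∑[ i < m ] (b i * fromℤ (w (suc i) l))

  sum-w′ : ∀ b l → ∑[ i < m ] (b i * fromℤ (w′ i l)) ≡
                   fromℤ p * S b l + - S b j * fromℤ (w zero l)
  sum-w′ b l = begin
    ∑[ i < m ] (b i * fromℤ (w′ i l))
      ≡⟨ ℚ-Sum.sum-cong-≗ (λ i → trans (cong (b i *_) (expand i))
           (solve 5 (λ b p x y z → b :* (p :* x :+ :- (y :* z))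
                       := p :* (b :* x) :+ (b :* y) :* (:- z)) refl
              (b i) (fromℤ p) (fromℤ (w (suc i) l)) (fromℤ (w (suc i) j)) (fromℤ (w zero l)))) ⟩
    ∑[ i < m ] (fromℤ p * (b i * fromℤ (w (suc i) l)) + b i * fromℤ (w (suc i) j) * - z)
      ≡⟨ ℚ-Sum.∑-distrib-+ (λ i → fromℤ p * (b i * fromℤ (w (suc i) l))) _ ⟩
    ∑[ i < m ] (fromℤ p * (b i * fromℤ (w (suc i) l))) +
      ∑[ i < m ] (b i * fromℤ (w (suc i) j) * - z)
      ≡⟨ cong₂ _+_ (ℚ-Sum.*-distribˡ-sum (fromℤ p) (λ i → b i * fromℤ (w (suc i) l)))
                   (ℚ-Sum.*-distribʳ-sum (- z) (λ i → b i * fromℤ (w (suc i) j))) ⟨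
    fromℤ p * S b l + S b j * - z
      ≡⟨ cong (λ u → fromℤ p * S b l + u)
           (solve 2 (λ s z → s :* (:- z) := (:- s) :* z) refl (S b j) z) ⟩
    fromℤ p * S b l + - S b j * z ∎
    where
    open ≡-Reasoning
    open ℚSolver.+-*-Solver
    z = fromℤ (w zero l)
    expand : ∀ i → fromℤ (w′ i l) ≡
             fromℤ p * fromℤ (w (suc i) l) + - (fromℤ (w (suc i) j) * z)
    expand i = trans (fromℤ-+ (p ℤ.* w (suc i) l) _)
      (cong₂ _+_ (fromℤ-* p _)
        (trans (fromℤ-neg (w (suc i) j ℤ.* w zero l)) (cong -_ (fromℤ-* (w (suc i) j) _))))

CommonDenominator : ∀ {m n} → (Fin m → Fin n → ℤ) → Set
CommonDenominator {m} w = Σ[ D ∈ ℤ ] D ≢ 0ℤ ×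
  ((x : Vector ℚ m) → (∀ l → IsInteger (∑[ i < m ] (x i * fromℤ (w i l)))) →
    ∀ i → IsInteger (fromℤ D * x i))

module Step {m n} (w : Fin (suc m) → Fin n → ℤ) (j : Fin n) (p≢0 : w zero j ≢ 0ℤ) where
  open Elimination w j
  open ℚSolver.+-*-Solver

  scaled : Vector ℚ m → Vector ℚ (suc m)
  scaled b = - S b j ∷ λ i → fromℤ p * b i

  sum-scaled : ∀ b l → ∑[ i < suc m ] (scaled b i * fromℤ (w i l)) ≡
                       ∑[ i < m ] (b i * fromℤ (w′ i l))
  sum-scaled b l = begin
    - S b j * z + ∑[ i < m ] (fromℤ p * b i * fromℤ (w (suc i) l))
      ≡⟨ cong (λ u → - S b j * z + u)
           (ℚ-Sum.sum-cong-≗ {x = λ i → fromℤ p * b i * fromℤ (w (suc i) l)}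
              (λ i → ℚ.*-assoc (fromℤ p) (b i) (fromℤ (w (suc i) l)))) ⟩
    - S b j * z + ∑[ i < m ] (fromℤ p * (b i * fromℤ (w (suc i) l)))
      ≡⟨ cong (λ u → - S b j * z + u)
           (ℚ-Sum.*-distribˡ-sum (fromℤ p) (λ i → b i * fromℤ (w (suc i) l))) ⟨
    - S b j * z + fromℤ p * S b l
      ≡⟨ ℚ.+-comm (- S b j * z) (fromℤ p * S b l) ⟩
    fromℤ p * S b l + - S b j * z
      ≡⟨ sum-w′ b l ⟨
    ∑[ i < m ] (b i * fromℤ (w′ i l)) ∎
    where
    open ≡-Reasoning
    z = fromℤ (w zero l)

  independent′ : Independent w → Independent w′
  independent′ ind b h i = begin
    b i                               ≡⟨ ℚ.*-identityˡ (b i) ⟨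
    1ℚ * b i                          ≡⟨ cong (_* b i) (ℚ.*-inverseˡ (fromℤ p)) ⟨
    ℚ.1/ fromℤ p * fromℤ p * b i      ≡⟨ ℚ.*-assoc (ℚ.1/ fromℤ p) (fromℤ p) (b i) ⟩
    ℚ.1/ fromℤ p * (fromℤ p * b i)    ≡⟨ cong (ℚ.1/ fromℤ p *_)
                                           (ind (scaled b) (λ l → trans (sum-scaled b l) (h l)) (suc i)) ⟩
    ℚ.1/ fromℤ p * 0ℚ                 ≡⟨ ℚ.*-zeroʳ (ℚ.1/ fromℤ p) ⟩
    0ℚ                                ∎
    where
    open ≡-Reasoning
    instance
      fromℤ-p≢0 : ℚ.NonZero (fromℤ p)
      fromℤ-p≢0 = ℚ.≢-nonZero (p≢0 ∘ fromℤ-injective)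

  module _ (D′ : ℤ) (x : Vector ℚ (suc m)) where
    y : Vector ℚ m
    y i = x (suc i)

    T : Fin n → ℚ
    T l = ∑[ i < suc m ] (x i * fromℤ (w i l))

    eq′ : ∀ l → ∑[ i < m ] (y i * fromℤ (w′ i l)) ≡
                fromℤ p * T l + - (T j * fromℤ (w zero l))
    eq′ l = trans (sum-w′ y l)
      (solve 5 (λ p s t x z → p :* s :+ (:- t) :* z
                  := p :* (x :* z :+ s) :+ (:- ((x :* p :+ t) :* z))) refl
         (fromℤ p) (S y l) (S y j) (x zero) (fromℤ (w zero l)))

    eqₛ : ∀ i → fromℤ (D′ ℤ.* p) * y i ≡ fromℤ p * (fromℤ D′ * y i)
    eqₛ i = trans (cong (_* y i) (fromℤ-* D′ p))
      (solve 3 (λ d p y → d :* p :* y := p :* (d :* y)) refl (fromℤ D′) (fromℤ p) (y i))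

    eq₀ : fromℤ (D′ ℤ.* p) * x zero ≡
          fromℤ D′ * T j + - ∑[ i < m ] (fromℤ D′ * y i * fromℤ (w (suc i) j))
    eq₀ = begin
      fromℤ (D′ ℤ.* p) * x zero
        ≡⟨ cong (_* x zero) (fromℤ-* D′ p) ⟩
      fromℤ D′ * fromℤ p * x zero
        ≡⟨ solve 4 (λ d p x s → d :* p :* x := d :* (x :* p :+ s) :+ (:- (d :* s))) refl
             (fromℤ D′) (fromℤ p) (x zero) (S y j) ⟩
      fromℤ D′ * T j + - (fromℤ D′ * S y j)
        ≡⟨ cong (λ u → fromℤ D′ * T j + - u)
             (ℚ-Sum.*-distribˡ-sum (fromℤ D′) (λ i → y i * fromℤ (w (suc i) j))) ⟩
      fromℤ D′ * T j + - ∑[ i < m ] (fromℤ D′ * (y i * fromℤ (w (suc i) j)))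
        ≡⟨ cong (λ u → fromℤ D′ * T j + - u)
             (ℚ-Sum.sum-cong-≗ {x = λ i → fromℤ D′ * y i * fromℤ (w (suc i) j)}
                (λ i → ℚ.*-assoc (fromℤ D′) (y i) (fromℤ (w (suc i) j)))) ⟨
      fromℤ D′ * T j + - ∑[ i < m ] (fromℤ D′ * y i * fromℤ (w (suc i) j)) ∎
      where open ≡-Reasoning

  step : CommonDenominator w′ → CommonDenominator w
  step (D′ , D′≢0 , integral′) = D′ ℤ.* p , D≢0 , integral
    where
    D≢0 : D′ ℤ.* p ≢ 0ℤ
    D≢0 eq with ℤ.i*j≡0⇒i≡0∨j≡0 D′ eq
    ... | inj₁ e = D′≢0 e
    ... | inj₂ e = p≢0 e

    integral : (x : Vector ℚ (suc m)) →
               (∀ l → IsInteger (∑[ i < suc m ] (x i * fromℤ (w i l)))) →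
               ∀ i → IsInteger (fromℤ (D′ ℤ.* p) * x i)
    integral x h = cases
      where
      tail-integral : ∀ i → IsInteger (fromℤ D′ * x (suc i))
      tail-integral = integral′ (x ∘ suc) λ l → subst IsInteger (sym (eq′ D′ x l))
        (int-+ (int-* (p , refl) (h l)) (int-neg (int-* (h j) (w zero l , refl))))

      cases : ∀ i → IsInteger (fromℤ (D′ ℤ.* p) * x i)
      cases zero = subst IsInteger (sym (eq₀ D′ x))
        (int-+ (int-* (D′ , refl) (h j))
               (int-neg (int-sum (λ i → fromℤ D′ * x (suc i) * fromℤ (w (suc i) j))
                 λ i → int-* (tail-integral i) (w (suc i) j , refl))))
      cases (suc i) = subst IsInteger (sym (eqₛ D′ x i)) (int-* (p , refl) (tail-integral i))

pivot : ∀ {m n} (w : Fin (suc m) → Fin n → ℤ) → Independent w → ∃[ j ] w zero j ≢ 0ℤ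
pivot {m} {n} w ind with Fin.any? (λ j → ¬? (w zero j ℤ.≟ 0ℤ))
... | yes found = found
... | no none = contradiction (ind (1ℚ ∷ replicate m 0ℚ) relation zero) λ ()
  where
  row-zero : ∀ l → w zero l ≡ 0ℤ
  row-zero l = decidable-stable (w zero l ℤ.≟ 0ℤ) (λ ne → none (l , ne))

  relation : ∀ l → ∑[ i < suc m ] ((1ℚ ∷ replicate m 0ℚ) i * fromℤ (w i l)) ≡ 0ℚ
  relation l = cong₂ _+_ (cong (λ u → 1ℚ * fromℤ u) (row-zero l))
    (sum-zero (λ i → 0ℚ * fromℤ (w (suc i) l)) (λ i → ℚ.*-zeroˡ (fromℤ (w (suc i) l))))

commonDenominator : ∀ m {n} (w : Fin m → Fin n → ℤ) → Independent w → CommonDenominator w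
commonDenominator zero    w ind = 1ℤ , (λ ()) , λ _ _ ()
commonDenominator (suc m) w ind = let j , p≢0 = pivot w ind in
  Step.step w j p≢0
    (commonDenominator m (Elimination.w′ w j) (Step.independent′ w j p≢0 ind))

floor≤ : ∀ q → fromℤ (floor q) ℚ.≤ q
floor≤ q@record{} = ℚ.*≤* {fromℤ (floor q)} {q}
  (subst (λ u → floor q ℤ.* ↧ q ℤ.≤ u) (sym (ℤ.*-identityʳ (↥ q))) (ℤ.[n/d]*d≤n (↥ q) (↧ q)))

<1+floor : ∀ q → q ℚ.< fromℤ (1ℤ ℤ.+ floor q)
<1+floor q@record{} = ℚ.*<* {q} {fromℤ (1ℤ ℤ.+ floor q)}
  (subst₂ ℤ._<_ (sym (ℤ.*-identityʳ (↥ q)))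
    (cong (λ u → (1ℤ ℤ.+ u) ℤ.* ↧ q) (sym (ℤ.div-pos-is-/ℕ (↥ q) (↧ₙ q))))
    (ℤ.n<s[n/ℕd]*d (↥ q) (↧ₙ q)))

0≤frac : ∀ q → 0ℚ ℚ.≤ frac q
0≤frac q = subst (ℚ._≤ frac q) (ℚ.+-inverseʳ F)
  (ℚ.+-monoˡ-≤ (- F) {F} {q} (floor≤ q))
  where F = fromℤ (floor q)

frac<1 : ∀ q → frac q ℚ.< 1ℚ
frac<1 q = subst (frac q ℚ.<_) cancel
  (ℚ.+-monoˡ-< (- F) {q} {fromℤ (1ℤ ℤ.+ floor q)} (<1+floor q))
  where
  F = fromℤ (floor q)
  cancel : fromℤ (1ℤ ℤ.+ floor q) - F ≡ 1ℚ
  cancel = trans (cong (λ u → u - F) (fromℤ-+ 1ℤ (floor q)))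
    (trans (ℚ.+-assoc 1ℚ F (- F))
      (trans (cong (λ u → 1ℚ + u) (ℚ.+-inverseʳ F)) (ℚ.+-identityʳ 1ℚ)))

frac-id : ∀ q → 0ℚ ℚ.≤ q → q ℚ.< 1ℚ → frac q ≡ q
frac-id q@(ℚ.mkℚ -[1+ n ] d _) 0≤q q<1 = contradiction (ℚ.drop-*≤* 0≤q) λ ()
frac-id q@(ℚ.mkℚ (+ n) d _) 0≤q q<1 = trans
  (cong (λ u → q - fromℤ u) (trans (ℤ.div-pos-is-/ℕ (+ n) (suc d)) (cong +_ (m<n⇒m/n≡0 n<d))))
  (ℚ.+-identityʳ q)
  where
  n<d : n ℕ.< suc d
  n<d = ℤ.drop‿+<+ (subst₂ ℤ._<_ (ℤ.*-identityʳ (+ n)) (ℤ.*-identityˡ (+ suc d))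
                      (ℚ.drop-*<* q<1))

fromℤ-cancel-≤ : ∀ {a b} → fromℤ a ℚ.≤ fromℤ b → a ℤ.≤ b
fromℤ-cancel-≤ {a} {b} h =
  subst₂ ℤ._≤_ (ℤ.*-identityʳ a) (ℤ.*-identityʳ b) (ℚ.drop-*≤* h)

fromℤ-cancel-< : ∀ {a b} → fromℤ a ℚ.< fromℤ b → a ℤ.< b
fromℤ-cancel-< {a} {b} h =
  subst₂ ℤ._<_ (ℤ.*-identityʳ a) (ℤ.*-identityʳ b) (ℚ.drop-*<* h)

fromℤ-mono-≤ : ∀ {a b} → a ℤ.≤ b → fromℤ a ℚ.≤ fromℤ b
fromℤ-mono-≤ {a} {b} h = ℚ.*≤*
  (subst₂ ℤ._≤_ (sym (ℤ.*-identityʳ a)) (sym (ℤ.*-identityʳ b)) h)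

fromℤ-mono-< : ∀ {a b} → a ℤ.< b → fromℤ a ℚ.< fromℤ b
fromℤ-mono-< {a} {b} h = ℚ.*<*
  (subst₂ ℤ._<_ (sym (ℤ.*-identityʳ a)) (sym (ℤ.*-identityʳ b)) h)

module Grid (D-1 : ℕ) where
  D : ℕ
  D = suc D-1

  Dℚ : ℚ
  Dℚ = fromℤ (+ D)

  grid : Fin D → ℚ
  grid a = ℚ.1/ Dℚ * fromℤ (+ toℕ a)

  D*grid : ∀ a → Dℚ * grid a ≡ fromℤ (+ toℕ a)
  D*grid a = trans (sym (ℚ.*-assoc Dℚ (ℚ.1/ Dℚ) _))
    (trans (cong (_* fromℤ (+ toℕ a)) (ℚ.*-inverseʳ Dℚ)) (ℚ.*-identityˡ _))

  frac-grid : ∀ a → frac (grid a) ≡ grid a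
  frac-grid a = frac-id (grid a)
    (ℚ.*-cancelˡ-≤-pos Dℚ (subst₂ ℚ._≤_ (sym (ℚ.*-zeroʳ Dℚ)) (sym (D*grid a))
      (fromℤ-mono-≤ (ℤ.+≤+ ℕ.z≤n))))
    (ℚ.*-cancelˡ-<-nonNeg Dℚ (subst₂ ℚ._<_ (sym (D*grid a)) (sym (ℚ.*-identityʳ Dℚ))
      (fromℤ-mono-< (ℤ.+<+ (Fin.toℕ<n a)))))

  onGrid : ∀ y → 0ℚ ℚ.≤ y → y ℚ.< 1ℚ → IsInteger (Dℚ * y) → ∃[ a ] y ≡ grid a
  onGrid y 0≤y y<1 (z , eq) = go z eq
    where
    0≤z : ∀ z → Dℚ * y ≡ fromℤ z → 0ℤ ℤ.≤ z
    0≤z z eq = fromℤ-cancel-≤ (subst₂ ℚ._≤_ (ℚ.*-zeroʳ Dℚ) eq (ℚ.*-monoˡ-≤-nonNeg Dℚ 0≤y))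
    go : ∀ z → Dℚ * y ≡ fromℤ z → ∃[ a ] y ≡ grid a
    go -[1+ n ] eq = contradiction (0≤z _ eq) λ ()
    go (+ n) eq = fromℕ< n<D , trans
      (sym (trans (sym (ℚ.*-assoc (ℚ.1/ Dℚ) Dℚ y))
        (trans (cong (_* y) (ℚ.*-inverseˡ Dℚ)) (ℚ.*-identityˡ y))))
      (cong (ℚ.1/ Dℚ *_) (trans eq (cong (fromℤ ∘ +_) (sym (Fin.toℕ-fromℕ< n<D)))))
      where
      n<D : n ℕ.< D
      n<D = ℤ.drop‿+<+ (fromℤ-cancel-< (subst₂ ℚ._<_ eq (ℚ.*-identityʳ Dℚ)
              (ℚ.*-monoʳ-<-pos Dℚ y<1)))

module _ {d} (Δ : LatticeSimplex d) where
  open LatticeSimplex Δ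

  -- Λ Δ x is Representative (frac ∘ x).
  Representative : Pred (Vector ℚ (suc d)) 0ℓ
  Representative y =
    (∀ j → IsInteger (∑[ i < suc d ] (y i * fromℤ (vertex i j)))) ×
    IsInteger (∑[ i < suc d ] y i)

  representative-resp : ∀ {x y} → x ≗ y → Representative x → Representative y
  representative-resp x≗y (h , k) =
    (λ j → subst IsInteger (ℚ-Sum.sum-cong-≗ λ i → cong (_* fromℤ (vertex i j)) (x≗y i)) (h j)) ,
    subst IsInteger (ℚ-Sum.sum-cong-≗ x≗y) k

  representative? : Decidable Representative
  representative? y = Fin.all? (λ j → isInteger? _) ×-dec isInteger? _

  homogenised : Fin (suc d) → Fin (suc d) → ℤ
  homogenised i = 1ℤ ∷ vertex i

  ones : ∀ (a : Vector ℚ (suc d)) → ∑[ i < suc d ] (a i * 1ℚ) ≡ sum a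
  ones a = ℚ-Sum.sum-cong-≗ (λ i → ℚ.*-identityʳ (a i))

  homogenised-independent : Independent homogenised
  homogenised-independent a h =
    affinelyIndependent a (trans (sym (ones a)) (h zero)) (h ∘ suc)

  homogenised-integral : ∀ y → Representative y →
    ∀ l → IsInteger (∑[ i < suc d ] (y i * fromℤ (homogenised i l)))
  homogenised-integral y (h , k) zero    = subst IsInteger (sym (ones y)) k
  homogenised-integral y (h , k) (suc j) = h j

  positiveDenominator : CommonDenominator homogenised →
    Σ[ D-1 ∈ ℕ ] (∀ y → Representative y → ∀ i → IsInteger (fromℤ (+ suc D-1) * y i))
  positiveDenominator (+ zero   , D≢0 , h) = contradiction refl D≢0
  positiveDenominator (+ suc n  , _   , h) = n , λ y r → h y (homogenised-integral y r)
  positiveDenominator (-[1+ n ] , _   , h) = n , λ y r i →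
    subst IsInteger (ℚ.neg-distribˡ-* (fromℤ -[1+ n ]) (y i))
      (int-neg (h y (homogenised-integral y r) i))

module _ {d} (Δ : LatticeSimplex d) (D-1 : ℕ)
         (clears : ∀ y → Representative Δ y → ∀ i → IsInteger (fromℤ (+ suc D-1) * y i)) where
  open Grid D-1

  gridPoint : Fin (D ℕ.^ suc d) → Vector ℚ (suc d)
  gridPoint k i = grid (finToFun k i)

  pointLCM : ∀ k → Σ[ L ∈ ℕ ] NonZero L × IsLCMOf (λ m → ∃[ i ] ⊤ × m ≡ ↧ₙ (gridPoint k i)) L
  pointLCM k = lcmFamily (λ i → ↧ₙ (gridPoint k i)) (λ _ → _) (λ _ → yes tt)

  gridLCM : Σ[ L ∈ ℕ ] NonZero L ×
            IsLCMOf (λ m → ∃[ k ] Representative Δ (gridPoint k) × m ≡ proj₁ (pointLCM k)) L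
  gridLCM = lcmFamily (proj₁ ∘ pointLCM) (proj₁ ∘ proj₂ ∘ pointLCM) (representative? Δ ∘ gridPoint)

  gridLCM-isLCM : IsLCMOf (Denominators Δ) (proj₁ gridLCM)
  gridLCM-isLCM = record { multiple = multiple ; least = least }
    where
    isL = proj₂ (proj₂ gridLCM)

    multiple : ∀ {n} → Denominators Δ n → n ∣ proj₁ gridLCM
    multiple {n} (x , x∈Λ , i , refl) = ∣-trans
      (IsLCMOf.multiple (proj₂ (proj₂ (pointLCM k))) (i , tt , cong ↧ₙ_ (y≗ i)))
      (IsLCMOf.multiple isL (k , representative-resp Δ y≗ x∈Λ , refl))
      where
      y : Vector ℚ (suc d)
      y = frac ∘ x
      located : ∀ i → ∃[ a ] y i ≡ grid a
      located i = onGrid (y i) (0≤frac (x i)) (frac<1 (x i)) (clears y x∈Λ i)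
      k = funToFin (proj₁ ∘ located)
      y≗ : y ≗ gridPoint k
      y≗ i = trans (proj₂ (located i))
        (cong grid (sym (Fin.finToFun-funToFin (proj₁ ∘ located) i)))

    least : ∀ {m} → (∀ {n} → Denominators Δ n → n ∣ m) → proj₁ gridLCM ∣ m
    least h = IsLCMOf.least isL λ { (k , r , refl) →
      IsLCMOf.least (proj₂ (proj₂ (pointLCM k))) λ { (i , _ , refl) →
        h (gridPoint k , representative-resp Δ (λ j → sym (frac-grid (finToFun k j))) r ,
           i , cong ↧ₙ_ (sym (frac-grid (finToFun k i)))) } }

abstract
  denominatorLCM : ∀ {d} (Δ : LatticeSimplex d) →
                   Σ[ N ∈ ℕ ] NonZero N × IsLCMOf (Denominators Δ) N
  denominatorLCM {d} Δ =
    let D-1 , clears = positiveDenominator Δ (commonDenominator (suc d) (homogenised Δ)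
                         (homogenised-independent Δ))
        N , N≢0 , _ = gridLCM Δ D-1 clears
    in N , N≢0 , gridLCM-isLCM Δ D-1 clears

-- Words over ℤ_N are vectors of residues in Fin N. Linearity is not built in.
record Code : Set₁ where
  field
    modulus         : ℕ
    {{modulus≢0}}   : NonZero modulus
    length          : ℕ
    words           : Pred (Vector (Fin modulus) length) 0ℓ

infix 4 _≅ᶜ_

_≅ᶜ_ : Code → Code → Set
C ≅ᶜ C′ =
  Σ[ eq ∈ C.modulus ≡ C′.modulus ] Σ[ σ ∈ Permutation C.length C′.length ]
    (∀ c → C.words c ⇔ C′.words (λ i → cast eq (c (σ ⟨$⟩ˡ i))))
  where module C = Code C
        module C′ = Code C′

-- Multiplication by k, as a map ℤ_M → ℤ_L; well defined when L divides k M.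
scale : ∀ {M n} k L .{{_ : NonZero L}} → Vector (Fin M) n → Vector (Fin L) n
scale k L c i = (k ℕ.* toℕ (c i)) mod L

infixl 6 _⊕_

_⊕_ : Code → Code → Code
C₁ ⊕ C₂ = record
  { modulus   = L
  ; modulus≢0 = L≢0
  ; length    = C₁.length ℕ.+ C₂.length
  ; words     = λ c → ∃[ c₁ ] ∃[ c₂ ] C₁.words c₁ × C₂.words c₂ ×
                  c ≗ (scale (L / C₁.modulus) L c₁ ++ scale (L / C₂.modulus) L c₂)
  }
  where
  module C₁ = Code C₁
  module C₂ = Code C₂
  L = lcm C₁.modulus C₂.modulus
  instance
    L≢0 : NonZero L
    L≢0 = lcm-nonZero C₁.modulus C₂.modulus

code : ∀ {d} → LatticeSimplex d → Code
code {d} Δ = record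
  { modulus   = N
  ; modulus≢0 = proj₁ (proj₂ (denominatorLCM Δ))
  ; length    = suc d
  ; words     = λ c → ∃[ x ] Λ Δ x × (∀ i → fromℤ (+ toℕ (c i)) ≡ fromℤ (+ N) * frac (x i))
  }
  where N = proj₁ (denominatorLCM Δ)

{-# OPTIONS --safe #-}
-- For a simplex with vertices vᵢ let L be the group of all x with Σ xᵢ (vᵢ , 1) integral.
-- It contains all integer vectors, so it is determined by Λ, hence by the code; and the
-- code's modulus is the common denominator of L. Both sides of the equivalence say that
-- the vertices of Δ and of the join can be matched so that the groups L correspond:
-- * for codes, because the L of the join is the direct sum of those of Δ₁ and Δ₂;
-- * for polytopes, because a unimodular isomorphism matches vertices and preserves L,
--   while conversely the affine map given by a matching sends the origin and the coordinate
--   directions, which have coordinates in L, to lattice points.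
module Submission where

open import Algebra.Bundles using (CommutativeRing)
import Algebra.Properties.Group
open import Data.Fin.Base
  using (Fin; zero; suc; punchIn; punchOut; _↑ˡ_; _↑ʳ_; splitAt; join; toℕ; cast)
open import Data.Fin.Permutation as Perm using (Permutation; permutation; _⟨$⟩ˡ_; _⟨$⟩ʳ_)
import Data.Fin.Properties as Fin
open import Data.Integer.Base as ℤ using (ℤ; 0ℤ; 1ℤ)
import Data.Integer.Properties as ℤ
open import Data.Nat.Base as ℕ using (ℕ; zero; suc; NonZero)
open import Data.Nat.Divisibility using (_∣_; divides; ∣-trans; ∣-antisym)
open import Data.Nat.DivMod using (_/_; _mod_; _%_; m/n*n≡m; m<n⇒m%n≡m)
open import Data.Nat.LCM using (m∣lcm[m,n]; n∣lcm[m,n]; lcm-least)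
import Data.Nat.Properties as ℕ
open import Data.Product.Base using (∃-syntax; Σ-syntax; _×_; _,_; proj₁; proj₂)
open import Data.Rational.Base as ℚ using (ℚ; 0ℚ; 1ℚ; _+_; _*_; _-_; -_; floor; ↥_; ↧_; ↧ₙ_)
open import Data.Rational.Literals using (fromℤ)
import Data.Rational.Properties as ℚ
import Data.Rational.Solver as ℚSolver
import Data.Rational.Unnormalised.Base as ℚᵘ
import Data.Rational.Unnormalised.Properties as ℚᵘ
open import Data.Sum.Base using (inj₁; inj₂)
open import Data.Vec.Functional using (Vector; _∷_; _++_; replicate)
open import Data.Vec.Functional.Properties using (lookup-++ˡ; lookup-++ʳ)
open import Function.Base using (_∘_; case_of_)
open import Function.Bundles using (_⇔_; mk⇔; Equivalence)
open import Function.Construct.Symmetry using (⇔-sym)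
open import Level using (0ℓ)
open import Relation.Binary.PropositionalEquality hiding (J)
open import Relation.Nullary using (Dec; yes; no; ¬?; contradiction)
open import Relation.Nullary.Decidable using (decidable-stable)
open import Relation.Unary using (Pred)

import Algebra.Properties.Semiring.Sum
  (CommutativeRing.semiring ℚ.+-*-commutativeRing) as ℚ-Sum
import Algebra.Properties.Semiring.Sum
  (CommutativeRing.semiring ℤ.+-*-commutativeRing) as ℤ-Sum

open import Defs

open Equivalence using (to; from)

-- Linear combinations and convex hulls

∑-*-assoc : ∀ {m n} (a : Vector ℚ m) (b : Fin m → Vector ℚ n) (c : Vector ℚ n) →
  ∑[ k < m ] (a k * ∑[ i < n ] (b k i * c i)) ≡ ∑[ i < n ] (∑[ k < m ] (a k * b k i) * c i)
∑-*-assoc {m} {n} a b c = begin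
  ∑[ k < m ] (a k * ∑[ i < n ] (b k i * c i))
    ≡⟨ ℚ-Sum.sum-cong-≗ (λ k → ℚ-Sum.*-distribˡ-sum (a k) (λ i → b k i * c i)) ⟩
  ∑[ k < m ] ∑[ i < n ] (a k * (b k i * c i))
    ≡⟨ ℚ-Sum.∑-comm (λ k i → a k * (b k i * c i)) ⟩
  ∑[ i < n ] ∑[ k < m ] (a k * (b k i * c i))
    ≡⟨ ℚ-Sum.sum-cong-≗ (λ i → trans
         (ℚ-Sum.sum-cong-≗ (λ k → sym (ℚ.*-assoc (a k) (b k i) (c i))))
         (sym (ℚ-Sum.*-distribʳ-sum (c i) (λ k → a k * b k i)))) ⟩
  ∑[ i < n ] (∑[ k < m ] (a k * b k i) * c i) ∎
  where open ≡-Reasoning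

∑-*-1 : ∀ {n} (a : Vector ℚ n) → ∑[ i < n ] (a i * 1ℚ) ≡ sum a
∑-*-1 a = ℚ-Sum.sum-cong-≗ (ℚ.*-identityʳ ∘ a)

sum-∑ : ∀ {m n} (a : Vector ℚ m) (b : Fin m → Vector ℚ n) →
  ∑[ i < n ] ∑[ k < m ] (a k * b k i) ≡ ∑[ k < m ] (a k * sum (b k))
sum-∑ {m} {n} a b = begin
  ∑[ i < n ] ∑[ k < m ] (a k * b k i)          ≡⟨ ∑-*-1 (λ i → ∑[ k < m ] (a k * b k i)) ⟨
  ∑[ i < n ] (∑[ k < m ] (a k * b k i) * 1ℚ)   ≡⟨ ∑-*-assoc a b (λ _ → 1ℚ) ⟨
  ∑[ k < m ] (a k * ∑[ i < n ] (b k i * 1ℚ))   ≡⟨ ℚ-Sum.sum-cong-≗ (λ k → cong (a k *_) (∑-*-1 (b k))) ⟩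
  ∑[ k < m ] (a k * sum (b k))                 ∎
  where open ≡-Reasoning

unit : ∀ {n} → Fin n → Vector ℚ n
unit i k = fromℤ (identityMatrix i k)

∑-unit : ∀ {n} (i : Fin n) (f : Vector ℚ n) → ∑[ k < n ] (unit i k * f k) ≡ f i
∑-unit {suc n} zero f = trans
  (cong₂ _+_ (ℚ.*-identityˡ (f zero)) (sum-zero (λ k → 0ℚ * f (suc k)) (ℚ.*-zeroˡ ∘ f ∘ suc)))
  (ℚ.+-identityʳ (f zero))
∑-unit {suc n} (suc i) f = trans
  (cong₂ _+_ (ℚ.*-zeroˡ (f zero)) (∑-unit i (f ∘ suc)))
  (ℚ.+-identityˡ (f (suc i)))

identityMatrix-sym : ∀ {n} (i j : Fin n) → identityMatrix i j ≡ identityMatrix j i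
identityMatrix-sym zero    zero    = refl
identityMatrix-sym zero    (suc j) = refl
identityMatrix-sym (suc i) zero    = refl
identityMatrix-sym (suc i) (suc j) = identityMatrix-sym i j

identityMatrix-diagonal : ∀ {n} (i : Fin n) → identityMatrix i i ≡ 1ℤ
identityMatrix-diagonal zero    = refl
identityMatrix-diagonal (suc i) = identityMatrix-diagonal i

identityMatrix≢0⇒≡ : ∀ {n} (i j : Fin n) → identityMatrix i j ≢ 0ℤ → i ≡ j
identityMatrix≢0⇒≡ zero    zero    h = refl
identityMatrix≢0⇒≡ zero    (suc j) h with () ← h refl
identityMatrix≢0⇒≡ (suc i) zero    h with () ← h refl
identityMatrix≢0⇒≡ (suc i) (suc j) h = cong suc (identityMatrix≢0⇒≡ i j h)

∑-unitʳ : ∀ {n} (i : Fin n) (f : Vector ℚ n) → ∑[ k < n ] (f k * unit k i) ≡ f i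
∑-unitʳ i f = trans
  (ℚ-Sum.sum-cong-≗ (λ k → trans (ℚ.*-comm (f k) (unit k i))
    (cong (λ z → fromℤ z * f k) (identityMatrix-sym k i))))
  (∑-unit i f)

sum-unit : ∀ {n} (i : Fin n) → sum (unit i) ≡ 1ℚ
sum-unit i = trans (sym (∑-*-1 (unit i))) (∑-unit i (λ _ → 1ℚ))

unit≥0 : ∀ {n} (i k : Fin n) → 0ℚ ℚ.≤ unit i k
unit≥0 zero    zero    = fromℤ-mono-≤ (ℤ.+≤+ ℕ.z≤n)
unit≥0 zero    (suc k) = ℚ.≤-refl
unit≥0 (suc i) zero    = ℚ.≤-refl
unit≥0 (suc i) (suc k) = unit≥0 i k

∑≥0 : ∀ {n} (f : Vector ℚ n) → (∀ i → 0ℚ ℚ.≤ f i) → 0ℚ ℚ.≤ sum f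
∑≥0 {zero}  f h = ℚ.≤-refl
∑≥0 {suc n} f h = ℚ.+-mono-≤ (h zero) (∑≥0 (f ∘ suc) (h ∘ suc))

*≥0 : ∀ {p q} → 0ℚ ℚ.≤ p → 0ℚ ℚ.≤ q → 0ℚ ℚ.≤ p * q
*≥0 {p} {q} h k = subst (ℚ._≤ p * q) (ℚ.*-zeroʳ p)
  (ℚ.*-monoˡ-≤-nonNeg p {{ℚ.nonNegative h}} k)

∑≡0⇒≡0 : ∀ {n} (f : Vector ℚ n) → (∀ i → 0ℚ ℚ.≤ f i) → sum f ≡ 0ℚ → ∀ i → f i ≡ 0ℚ
∑≡0⇒≡0 {suc n} f h eq = λ where
    zero    → head≡0
    (suc i) → ∑≡0⇒≡0 (f ∘ suc) (h ∘ suc) tail≡0 i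
  where
  tail≥0 : 0ℚ ℚ.≤ sum (f ∘ suc)
  tail≥0 = ∑≥0 (f ∘ suc) (h ∘ suc)
  head≡0 : f zero ≡ 0ℚ
  head≡0 = ℚ.≤-antisym
    (subst₂ ℚ._≤_ (ℚ.+-identityʳ (f zero)) eq (ℚ.+-monoʳ-≤ (f zero) tail≥0)) (h zero)
  tail≡0 : sum (f ∘ suc) ≡ 0ℚ
  tail≡0 = trans (sym (ℚ.+-identityˡ _)) (trans (cong (_+ sum (f ∘ suc)) (sym head≡0)) eq)

comb : ∀ {n d} → Vector ℚ n → Vector (LatticePoint d) n → Point d
comb {n} a V j = ∑[ i < n ] (a i * fromℤ (V i j))

comb-cong : ∀ {n d} {a b : Vector ℚ n} (V : Vector (LatticePoint d) n) → a ≗ b → comb a V ≗ comb b V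
comb-cong V eq j = ℚ-Sum.sum-cong-≗ (λ i → cong (_* fromℤ (V i j)) (eq i))

comb-unit : ∀ {n d} (V : Vector (LatticePoint d) n) i → comb (unit i) V ≗ fromℤ ∘ V i
comb-unit V i j = ∑-unit i (λ k → fromℤ (V k j))

module _ {n d} {V : Vector (LatticePoint d) n} (ind : AffinelyIndependent V) where

  comb-injective : ∀ a b → sum a ≡ sum b → comb a V ≗ comb b V → a ≗ b
  comb-injective a b sums combs i = begin
    a i                  ≡⟨ solve 2 (λ x y → x := (x :+ con -1ℚ :* y) :+ y) refl (a i) (b i) ⟩
    a i + -1ℚ * b i + b i  ≡⟨ cong (_+ b i) (ind c sum-c (λ j → trans (comb-c j) (cancel (combs j))) i) ⟩
    0ℚ + b i             ≡⟨ ℚ.+-identityˡ (b i) ⟩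
    b i                  ∎
    where
    open ≡-Reasoning
    open ℚSolver.+-*-Solver
    -1ℚ = - 1ℚ
    c : Vector ℚ n
    c i = a i + -1ℚ * b i
    cancel : ∀ {p q} → p ≡ q → p + -1ℚ * q ≡ 0ℚ
    cancel {p} refl = solve 1 (λ p → p :+ con -1ℚ :* p := con 0ℚ) refl p
    sum-c : sum c ≡ 0ℚ
    sum-c = trans (ℚ-Sum.∑-distrib-+ a (λ i → -1ℚ * b i))
      (trans (cong (λ u → sum a + u) (sym (ℚ-Sum.*-distribˡ-sum -1ℚ b))) (cancel sums))
    comb-c : ∀ j → comb c V j ≡ comb a V j + -1ℚ * comb b V j
    comb-c j = begin
      comb c V j
        ≡⟨ ℚ-Sum.sum-cong-≗ (λ i → solve 4 (λ a m b v → (a :+ m :* b) :* v := a :* v :+ m :* (b :* v)) refl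
             (a i) -1ℚ (b i) (fromℤ (V i j))) ⟩
      ∑[ i < n ] (a i * fromℤ (V i j) + -1ℚ * (b i * fromℤ (V i j)))
        ≡⟨ ℚ-Sum.∑-distrib-+ (λ i → a i * fromℤ (V i j)) (λ i → -1ℚ * (b i * fromℤ (V i j))) ⟩
      comb a V j + ∑[ i < n ] (-1ℚ * (b i * fromℤ (V i j)))
        ≡⟨ cong (λ u → comb a V j + u) (ℚ-Sum.*-distribˡ-sum -1ℚ (λ i → b i * fromℤ (V i j))) ⟨
      comb a V j + -1ℚ * comb b V j ∎

  vertex-injective : ∀ {i k} → V i ≗ V k → i ≡ k
  vertex-injective {i} {k} eq = identityMatrix≢0⇒≡ i k λ eq₀ →
    1≢0 (trans (sym (identityMatrix-diagonal k)) (trans (sym (fromℤ-injective (units k))) eq₀))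
    where
    1≢0 : 1ℤ ≢ 0ℤ
    1≢0 ()
    units : unit i ≗ unit k
    units = comb-injective (unit i) (unit k) (trans (sum-unit i) (sym (sum-unit k)))
      (λ j → trans (comb-unit V i j) (trans (cong fromℤ (eq j)) (sym (comb-unit V k j))))

Hull : ∀ {n d} → Vector (LatticePoint d) n → Pred (Point d) 0ℓ
Hull {n} V x = Σ[ μ ∈ Vector ℚ n ] (∀ i → 0ℚ ℚ.≤ μ i) × sum μ ≡ 1ℚ × x ≗ comb μ V

vertex∈Hull : ∀ {n d} (V : Vector (LatticePoint d) n) i {p} → p ≗ fromℤ ∘ V i → Hull V p
vertex∈Hull V i eq = unit i , unit≥0 i , sum-unit i , λ j → trans (eq j) (sym (comb-unit V i j))

Hull-convex : ∀ {m n d} (V : Vector (LatticePoint d) n) (λs : Vector ℚ m) (p : Vector (Point d) m) →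
  (∀ k → Hull V (p k)) → (∀ k → 0ℚ ℚ.≤ λs k) → sum λs ≡ 1ℚ →
  ∀ {x} → (∀ j → x j ≡ ∑[ k < m ] (λs k * p k j)) → Hull V x
Hull-convex {m} V λs p h λs≥0 sum-λs x≡ =
  (λ i → ∑[ k < m ] (λs k * μ k i)) ,
  (λ i → ∑≥0 (λ k → λs k * μ k i) (λ k → *≥0 (λs≥0 k) (proj₁ (proj₂ (h k)) i))) ,
  trans (sum-∑ λs μ)
    (trans (ℚ-Sum.sum-cong-≗ (λ k → cong (λs k *_) (proj₁ (proj₂ (proj₂ (h k))))))
      (trans (∑-*-1 λs) sum-λs)) ,
  λ j → trans (x≡ j)
    (trans (ℚ-Sum.sum-cong-≗ (λ k → cong (λs k *_) (proj₂ (proj₂ (proj₂ (h k))) j)))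
      (∑-*-assoc λs μ (λ i → fromℤ (V i j))))
  where
  μ = λ k → proj₁ (h k)

linear : ∀ {d e} → (Fin e → Fin d → ℤ) → Point d → Point e
linear {d} A x i = ∑[ j < d ] (fromℤ (A i j) * x j)

∑-affine : ∀ {n d e} (A : Fin e → Fin d → ℤ) (b : LatticePoint e) (a : Vector ℚ n) (p : Fin n → Point d) i →
  ∑[ k < n ] (a k * (linear A (p k) i + fromℤ (b i))) ≡
  linear A (λ j → ∑[ k < n ] (a k * p k j)) i + sum a * fromℤ (b i)
∑-affine {n} {d} A b a p i = begin
  ∑[ k < n ] (a k * (linear A (p k) i + β))
    ≡⟨ ℚ-Sum.sum-cong-≗ (λ k → ℚ.*-distribˡ-+ (a k) (linear A (p k) i) β) ⟩
  ∑[ k < n ] (a k * linear A (p k) i + a k * β)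
    ≡⟨ ℚ-Sum.∑-distrib-+ (λ k → a k * linear A (p k) i) (λ k → a k * β) ⟩
  ∑[ k < n ] (a k * linear A (p k) i) + ∑[ k < n ] (a k * β)
    ≡⟨ cong₂ _+_ swap (sym (ℚ-Sum.*-distribʳ-sum β a)) ⟩
  linear A (λ j → ∑[ k < n ] (a k * p k j)) i + sum a * β ∎
  where
  open ≡-Reasoning
  β = fromℤ (b i)
  swap : ∑[ k < n ] (a k * linear A (p k) i) ≡ linear A (λ j → ∑[ k < n ] (a k * p k j)) i
  swap = begin
    ∑[ k < n ] (a k * linear A (p k) i)
      ≡⟨ ℚ-Sum.sum-cong-≗ (λ k → cong (a k *_)
           (ℚ-Sum.sum-cong-≗ (λ j → ℚ.*-comm (fromℤ (A i j)) (p k j)))) ⟩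
    ∑[ k < n ] (a k * ∑[ j < d ] (p k j * fromℤ (A i j)))
      ≡⟨ ∑-*-assoc a p (λ j → fromℤ (A i j)) ⟩
    ∑[ j < d ] (∑[ k < n ] (a k * p k j) * fromℤ (A i j))
      ≡⟨ ℚ-Sum.sum-cong-≗ (λ j → ℚ.*-comm (∑[ k < n ] (a k * p k j)) (fromℤ (A i j))) ⟩
    linear A (λ j → ∑[ k < n ] (a k * p k j)) i ∎

linear-cong : ∀ {d e} (A : Fin e → Fin d → ℤ) {x y : Point d} → x ≗ y → linear A x ≗ linear A y
linear-cong A eq i = ℚ-Sum.sum-cong-≗ (λ j → cong (fromℤ (A i j) *_) (eq j))

fromℤ-sum : ∀ {n} (f : Vector ℤ n) → fromℤ (ℤ-Sum.sum f) ≡ sum (fromℤ ∘ f)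
fromℤ-sum {zero}  f = refl
fromℤ-sum {suc n} f = trans (fromℤ-+ (f zero) _) (cong (fromℤ (f zero) +_) (fromℤ-sum (f ∘ suc)))

fromℤ-product : ∀ {d e f} (B : Fin f → Fin e → ℤ) (A : Fin e → Fin d → ℤ) i j →
  fromℤ (ℤ-Sum.sum (λ k → B i k ℤ.* A k j)) ≡ ∑[ k < e ] (fromℤ (B i k) * fromℤ (A k j))
fromℤ-product B A i j = trans (fromℤ-sum (λ k → B i k ℤ.* A k j))
  (ℚ-Sum.sum-cong-≗ (λ k → fromℤ-* (B i k) (A k j)))

linear-inverse : ∀ {d e} (A : Fin e → Fin d → ℤ) (B : Fin d → Fin e → ℤ) →
  (∀ i j → ℤ-Sum.sum (λ k → B i k ℤ.* A k j) ≡ identityMatrix i j) →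
  ∀ x → linear B (linear A x) ≗ x
linear-inverse A B BA≡I x i = begin
  linear B (linear A x) i
    ≡⟨ ∑-*-assoc (λ k → fromℤ (B i k)) (λ k j → fromℤ (A k j)) x ⟩
  ∑[ j < _ ] (∑[ k < _ ] (fromℤ (B i k) * fromℤ (A k j)) * x j)
    ≡⟨ ℚ-Sum.sum-cong-≗ (λ j → cong (_* x j)
         (trans (sym (fromℤ-product B A i j)) (cong fromℤ (BA≡I i j)))) ⟩
  ∑[ j < _ ] (unit i j * x j)
    ≡⟨ ∑-unit i x ⟩
  x i ∎
  where open ≡-Reasoning

-- Coordinates with respect to affinely independent vertices

punchIn-cover : ∀ {n} (j : Fin (suc n)) {P : Fin (suc n) → Set} →
  P j → (∀ l → P (punchIn j l)) → ∀ l → P l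
punchIn-cover j {P} pj h l with j Fin.≟ l
... | yes refl = pj
... | no j≢l   = subst P (Fin.punchIn-punchOut j≢l) (h (punchOut j≢l))

module Pivot {m n} (w : Fin (suc m) → Fin (suc n) → ℤ) (j : Fin (suc n)) (p≢0 : w zero j ≢ 0ℤ) where
  open Elimination w j
  open Step w j p≢0
  open ≡-Reasoning

  w″ : Fin m → Fin n → ℤ
  w″ i l = w′ i (punchIn j l)

  pivot-column : ∀ (b : Vector ℚ m) → ∑[ i < m ] (b i * fromℤ (w′ i j)) ≡ 0ℚ
  pivot-column b = sum-zero (λ i → b i * fromℤ (w′ i j)) λ i → trans
    (cong (λ z → b i * fromℤ z)
      (trans (cong (ℤ._- w (suc i) j ℤ.* p) (ℤ.*-comm p (w (suc i) j)))
             (ℤ.+-inverseʳ (w (suc i) j ℤ.* p))))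
    (ℚ.*-zeroʳ (b i))

  independent″ : Independent w → Independent w″
  independent″ ind b h = independent′ ind b (punchIn-cover j (pivot-column b) h)

  module _ (u : Vector ℚ (suc n)) where
    private instance
      fromℤ-p≢0 : ℚ.NonZero (fromℤ p)
      fromℤ-p≢0 = ℚ.≢-nonZero (p≢0 ∘ fromℤ-injective)

    c : ℚ
    c = u j * ℚ.1/ fromℤ p

    remainder : Vector ℚ (suc n)
    remainder l = u l - c * fromℤ (w zero l)

    c*p : c * fromℤ p ≡ u j
    c*p = trans (ℚ.*-assoc (u j) (ℚ.1/ fromℤ p) (fromℤ p))
      (trans (cong (u j *_) (ℚ.*-inverseˡ (fromℤ p))) (ℚ.*-identityʳ (u j)))

    lift-solution : ∀ (b : Vector ℚ m) → (∀ l → ∑[ i < m ] (b i * fromℤ (w″ i l)) ≡ remainder (punchIn j l)) →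
      Σ[ a ∈ Vector ℚ (suc m) ] (∀ l → ∑[ i < suc m ] (a i * fromℤ (w i l)) ≡ u l)
    lift-solution b h = a , λ l → begin
      (- S b j + c) * z l + R l          ≡⟨ cong (_+ R l) (ℚ.*-distribʳ-+ (z l) (- S b j) c) ⟩
      - S b j * z l + c * z l + R l
        ≡⟨ solve 3 (λ x y r → x :+ y :+ r := (x :+ r) :+ y) refl (- S b j * z l) (c * z l) (R l) ⟩
      - S b j * z l + R l + c * z l      ≡⟨ cong (_+ c * z l) (trans (sum-scaled b l) (h′ l)) ⟩
      u l - c * z l + c * z l            ≡⟨ solve 2 (λ x y → x :+ :- y :+ y := x) refl (u l) (c * z l) ⟩
      u l                                ∎
      where
      open ℚSolver.+-*-Solver
      a : Vector ℚ (suc m)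
      a = (- S b j + c) ∷ λ i → fromℤ p * b i
      z R : Vector ℚ (suc n)
      z l = fromℤ (w zero l)
      R l = ∑[ i < m ] (fromℤ p * b i * fromℤ (w (suc i) l))
      h′ : ∀ l → ∑[ i < m ] (b i * fromℤ (w′ i l)) ≡ remainder l
      h′ = punchIn-cover j (trans (pivot-column b)
        (sym (trans (cong (λ x → u j - x) c*p) (ℚ.+-inverseʳ (u j))))) h

Spanning : ∀ {m n} → (Fin m → Fin n → ℤ) → Set
Spanning {m} {n} w = (u : Vector ℚ n) → Σ[ a ∈ Vector ℚ m ] (∀ l → ∑[ i < m ] (a i * fromℤ (w i l)) ≡ u l)

spanning-step : ∀ {m n} (w : Fin (suc m) → Fin (suc n) → ℤ) j (p≢0 : w zero j ≢ 0ℤ) →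
  Spanning (Pivot.w″ w j p≢0) → Spanning w
spanning-step w j p≢0 h u = lift-solution u (proj₁ b) (proj₂ b)
  where
  open Pivot w j p≢0
  b = h (remainder u ∘ punchIn j)

spanning : ∀ {m n} (w : Fin m → Fin n → ℤ) → m ≡ n → Independent w → Spanning w
spanning {zero}  {zero}  w _  ind u = u , λ ()
spanning {suc m} {suc n} w eq ind = spanning-step w (proj₁ pivot₀) (proj₂ pivot₀)
  (spanning _ (ℕ.suc-injective eq) (Pivot.independent″ w (proj₁ pivot₀) (proj₂ pivot₀) ind))
  where
  pivot₀ = pivot w ind

Lattice : ∀ {n d} → Vector (LatticePoint d) n → Vector ℚ n → Set
Lattice V x = (∀ j → IsInteger (comb x V j)) × IsInteger (sum x)

record AffineMap {n d e} (V : Vector (LatticePoint d) n) (W : Vector (LatticePoint e) n) : Set where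
  field
    matrix      : Fin e → Fin d → ℤ
    translation : LatticePoint e
    maps        : ∀ k i → linear matrix (fromℤ ∘ V k) i + fromℤ (translation i) ≡ fromℤ (W k i)

  comb-image : ∀ a i → comb a W i ≡ linear matrix (comb a V) i + sum a * fromℤ (translation i)
  comb-image a i = trans (ℚ-Sum.sum-cong-≗ (λ k → cong (a k *_) (sym (maps k i))))
    (∑-affine matrix translation a (λ k → fromℤ ∘ V k) i)

module Frame {n d} {V : Vector (LatticePoint d) n} (ind : AffinelyIndependent V) (n≡1+d : n ≡ suc d) where
  homog : Fin n → Fin (suc d) → ℤ
  homog i = 1ℤ ∷ V i

  dual : ∀ l → Σ[ a ∈ Vector ℚ n ] (∀ l′ → ∑[ i < n ] (a i * fromℤ (homog i l′)) ≡ unit l l′)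
  dual l = spanning homog n≡1+d (λ a h → ind a (trans (sym (∑-*-1 a)) (h zero)) (h ∘ suc)) (unit l)

  -- Barycentric coordinates of the origin and of the coordinate directions.
  origin : Vector ℚ n
  origin = proj₁ (dual zero)

  axis : Fin d → Vector ℚ n
  axis j = proj₁ (dual (suc j))

  sum-origin : sum origin ≡ 1ℚ
  sum-origin = trans (sym (∑-*-1 origin)) (proj₂ (dual zero) zero)

  sum-axis : ∀ j → sum (axis j) ≡ 0ℚ
  sum-axis j = trans (sym (∑-*-1 (axis j))) (proj₂ (dual (suc j)) zero)

  comb-origin : ∀ l → comb origin V l ≡ 0ℚ
  comb-origin l = proj₂ (dual zero) (suc l)

  comb-axis : ∀ j l → comb (axis j) V l ≡ unit j l
  comb-axis j l = proj₂ (dual (suc j)) (suc l)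

  origin∈Lattice : Lattice V origin
  origin∈Lattice = (λ j → 0ℤ , comb-origin j) , 1ℤ , sum-origin

  axis∈Lattice : ∀ j → Lattice V (axis j)
  axis∈Lattice j = (λ l → identityMatrix j l , comb-axis j l) , 0ℤ , sum-axis j

  expand-vertex : ∀ k i → ∑[ j < d ] (fromℤ (V k j) * axis j i) + origin i ≡ unit k i
  expand-vertex k = comb-injective ind (λ i → X i + origin i) (unit k)
    (trans sum-X+origin (sym (sum-unit k)))
    (λ l → trans (comb-X+origin l) (sym (comb-unit V k l)))
    where
    X : Vector ℚ n
    X i = ∑[ j < d ] (fromℤ (V k j) * axis j i)
    sum-X+origin : sum (λ i → X i + origin i) ≡ 1ℚ
    sum-X+origin = trans (ℚ-Sum.∑-distrib-+ X origin) (cong₂ _+_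
      (trans (sum-∑ (fromℤ ∘ V k) axis)
        (sum-zero (λ j → fromℤ (V k j) * sum (axis j))
          (λ j → trans (cong (fromℤ (V k j) *_) (sum-axis j)) (ℚ.*-zeroʳ (fromℤ (V k j))))))
      sum-origin)
    comb-X+origin : ∀ l → comb (λ i → X i + origin i) V l ≡ fromℤ (V k l)
    comb-X+origin l = trans
      (ℚ-Sum.sum-cong-≗ (λ i → ℚ.*-distribʳ-+ (fromℤ (V i l)) (X i) (origin i)))
      (trans (ℚ-Sum.∑-distrib-+ (λ i → X i * fromℤ (V i l)) (λ i → origin i * fromℤ (V i l)))
        (trans (cong₂ _+_
          (trans (sym (∑-*-assoc (fromℤ ∘ V k) axis (λ i → fromℤ (V i l))))
            (trans (ℚ-Sum.sum-cong-≗ (λ j → cong (fromℤ (V k j) *_) (comb-axis j l)))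
              (∑-unitʳ l (fromℤ ∘ V k))))
          (comb-origin l))
          (ℚ.+-identityʳ (fromℤ (V k l)))))

  affineMap : ∀ {e} (W : Vector (LatticePoint e) n) → (∀ x → Lattice V x → Lattice W x) → AffineMap V W
  affineMap W V⊆W = record
    { matrix      = λ i j → proj₁ (column j i)
    ; translation = λ i → proj₁ (image i)
    ; maps        = maps
    }
    where
    column = λ j → proj₁ (V⊆W (axis j) (axis∈Lattice j))
    image = proj₁ (V⊆W origin origin∈Lattice)
    maps : ∀ k i → linear (λ i j → proj₁ (column j i)) (fromℤ ∘ V k) i + fromℤ (proj₁ (image i)) ≡ fromℤ (W k i)
    maps k i = begin
      ∑[ j < d ] (fromℤ (proj₁ (column j i)) * fromℤ (V k j)) + fromℤ (proj₁ (image i))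
        ≡⟨ cong₂ _+_
             (ℚ-Sum.sum-cong-≗ (λ j → trans (ℚ.*-comm (fromℤ (proj₁ (column j i))) (fromℤ (V k j)))
               (cong (fromℤ (V k j) *_) (sym (proj₂ (column j i))))))
             (sym (proj₂ (image i))) ⟩
      ∑[ j < d ] (fromℤ (V k j) * comb (axis j) W i) + comb origin W i
        ≡⟨ cong (_+ comb origin W i) (∑-*-assoc (fromℤ ∘ V k) axis (λ l → fromℤ (W l i))) ⟩
      ∑[ l < n ] (X l * fromℤ (W l i)) + comb origin W i
        ≡⟨ ℚ-Sum.∑-distrib-+ (λ l → X l * fromℤ (W l i)) (λ l → origin l * fromℤ (W l i)) ⟨
      ∑[ l < n ] (X l * fromℤ (W l i) + origin l * fromℤ (W l i))
        ≡⟨ ℚ-Sum.sum-cong-≗ (λ l → trans (sym (ℚ.*-distribʳ-+ (fromℤ (W l i)) (X l) (origin l)))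
             (cong (_* fromℤ (W l i)) (expand-vertex k l))) ⟩
      comb (unit k) W i
        ≡⟨ comb-unit W k i ⟩
      fromℤ (W k i) ∎
      where
      open ≡-Reasoning
      X : Vector ℚ n
      X l = ∑[ j < d ] (fromℤ (V k j) * axis j l)

  product-identity : ∀ {e} {W : Vector (LatticePoint e) n} (f : AffineMap V W) (g : AffineMap W V) →
    ∀ i j → ℤ-Sum.sum (λ k → AffineMap.matrix g i k ℤ.* AffineMap.matrix f k j) ≡ identityMatrix i j
  product-identity {W = W} f g i j = fromℤ-injective (begin
    fromℤ (ℤ-Sum.sum (λ k → B i k ℤ.* A k j))
      ≡⟨ fromℤ-product B A i j ⟩
    linear B (λ k → fromℤ (A k j)) i
      ≡⟨ linear-cong B column i ⟨
    linear B (comb (axis j) W) i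
      ≡⟨ drop (linear B (comb (axis j) W) i) (AffineMap.translation g i) ⟨
    linear B (comb (axis j) W) i + sum (axis j) * fromℤ (AffineMap.translation g i)
      ≡⟨ AffineMap.comb-image g (axis j) i ⟨
    comb (axis j) V i
      ≡⟨ comb-axis j i ⟩
    unit j i
      ≡⟨ cong fromℤ (identityMatrix-sym j i) ⟩
    unit i j ∎)
    where
    open ≡-Reasoning
    A = AffineMap.matrix f
    B = AffineMap.matrix g
    drop : ∀ x b → x + sum (axis j) * fromℤ b ≡ x
    drop x b = trans (cong (λ s → x + s * fromℤ b) (sum-axis j))
      (trans (cong (x +_) (ℚ.*-zeroˡ (fromℤ b))) (ℚ.+-identityʳ x))
    column : ∀ k → comb (axis j) W k ≡ fromℤ (A k j)
    column k = begin
      comb (axis j) W k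
        ≡⟨ AffineMap.comb-image f (axis j) k ⟩
      linear A (comb (axis j) V) k + sum (axis j) * fromℤ (AffineMap.translation f k)
        ≡⟨ drop (linear A (comb (axis j) V) k) (AffineMap.translation f k) ⟩
      linear A (comb (axis j) V) k
        ≡⟨ linear-cong A (λ l → trans (comb-axis j l) (cong fromℤ (identityMatrix-sym j l))) k ⟩
      ∑[ l < d ] (fromℤ (A k l) * unit l j)
        ≡⟨ ∑-unitʳ j (fromℤ ∘ A k) ⟩
      fromℤ (A k j) ∎

-- Unimodular isomorphism

+-cancelʳ : ∀ r p q → p + r ≡ q + r → p ≡ q
+-cancelʳ = Algebra.Properties.Group.∙-cancelʳ ℚ.+-0-group

identityMatrix-offDiagonal : ∀ {n} {i j : Fin n} → i ≢ j → identityMatrix i j ≡ 0ℤ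
identityMatrix-offDiagonal {i = i} {j} i≢j =
  decidable-stable (identityMatrix i j ℤ.≟ 0ℤ) (i≢j ∘ identityMatrix≢0⇒≡ i j)

1/-cancelˡ : ∀ p .{{_ : ℚ.NonZero p}} q → ℚ.1/ p * (p * q) ≡ q
1/-cancelˡ p q = trans (sym (ℚ.*-assoc (ℚ.1/ p) p q))
  (trans (cong (_* q) (ℚ.*-inverseˡ p)) (ℚ.*-identityˡ q))

*≡0⇒≡0 : ∀ p q → p ≢ 0ℚ → p * q ≡ 0ℚ → q ≡ 0ℚ
*≡0⇒≡0 p q p≢0 eq = trans (sym (1/-cancelˡ p q))
  (trans (cong (ℚ.1/ p *_) eq) (ℚ.*-zeroʳ (ℚ.1/ p)))
  where
  instance
    p-nonZero : ℚ.NonZero p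
    p-nonZero = ℚ.≢-nonZero p≢0

stochastic-product : ∀ {p q r} (a : Fin p → Fin q → ℚ) (b : Fin q → Fin r → ℚ) →
  (∀ i → sum (a i) ≡ 1ℚ) → (∀ k → sum (b k) ≡ 1ℚ) →
  ∀ i → sum (λ l → ∑[ k < q ] (a i k * b k l)) ≡ 1ℚ
stochastic-product a b sum-a sum-b i = trans (sum-∑ (a i) b)
  (trans (ℚ-Sum.sum-cong-≗ (λ k → cong (a i k *_) (sum-b k))) (trans (∑-*-1 (a i)) (sum-a i)))

-- A nonnegative matrix with a nonnegative inverse is monomial: if Mᵢₖ ≠ 0, then
-- the vanishing off-diagonal entries of M B in row i kill Bₖᵢ′ for all i′ ≠ i.
stochastic-inverse : ∀ {m n} (M : Fin m → Fin n → ℚ) (B : Fin n → Fin m → ℚ) →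
  (∀ i k → 0ℚ ℚ.≤ M i k) → (∀ k i → 0ℚ ℚ.≤ B k i) →
  (∀ i → sum (M i) ≡ 1ℚ) → (∀ k → sum (B k) ≡ 1ℚ) →
  (∀ i i′ → ∑[ k < n ] (M i k * B k i′) ≡ unit i i′) →
  ∀ i → ∃[ k ] B k ≗ unit i
stochastic-inverse {m} {n} M B M≥0 B≥0 sum-M sum-B MB≡I i with Fin.any? (λ k → ¬? (M i k ℚ.≟ 0ℚ))
... | no none = contradiction (trans (sym (sum-M i)) (sum-zero (M i) M≡0)) λ ()
  where
  M≡0 : ∀ k → M i k ≡ 0ℚ
  M≡0 k = decidable-stable (M i k ℚ.≟ 0ℚ) (λ ne → none (k , ne))
... | yes (k , Mik≢0) = k , λ i′ → trans (multiple i′)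
    (trans (cong (_* unit i i′) B≡1) (ℚ.*-identityˡ (unit i i′)))
  where
  offDiagonal : ∀ i′ → i ≢ i′ → B k i′ ≡ 0ℚ
  offDiagonal i′ i≢i′ = *≡0⇒≡0 (M i k) (B k i′) Mik≢0
    (∑≡0⇒≡0 (λ k → M i k * B k i′) (λ k → *≥0 (M≥0 i k) (B≥0 k i′))
      (trans (MB≡I i i′) (cong fromℤ (identityMatrix-offDiagonal i≢i′))) k)
  multiple : ∀ i′ → B k i′ ≡ B k i * unit i i′
  multiple i′ = cases (i Fin.≟ i′)
    where
    cases : Dec (i ≡ i′) → B k i′ ≡ B k i * unit i i′
    cases (yes refl) = sym (trans (cong (λ z → B k i * fromℤ z) (identityMatrix-diagonal i))
                             (ℚ.*-identityʳ (B k i)))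
    cases (no i≢i′) = trans (offDiagonal i′ i≢i′)
      (sym (trans (cong (λ z → B k i * fromℤ z) (identityMatrix-offDiagonal i≢i′))
        (ℚ.*-zeroʳ (B k i))))
  B≡1 : B k i ≡ 1ℚ
  B≡1 = begin
    B k i                             ≡⟨ ℚ.*-identityʳ (B k i) ⟨
    B k i * 1ℚ                        ≡⟨ cong (B k i *_) (sum-unit i) ⟨
    B k i * sum (unit i)              ≡⟨ ℚ-Sum.*-distribˡ-sum (B k i) (unit i) ⟩
    ∑[ i′ < m ] (B k i * unit i i′)   ≡⟨ ℚ-Sum.sum-cong-≗ multiple ⟨
    sum (B k)                         ≡⟨ sum-B k ⟩
    1ℚ                                ∎
    where open ≡-Reasoning

LatticeIsomorphic : ∀ {m n d e} → Vector (LatticePoint d) m → Vector (LatticePoint e) n → Set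
LatticeIsomorphic {m} {n} V W =
  Σ[ σ ∈ Permutation m n ] (∀ x → Lattice V x ⇔ Lattice W (λ k → x (σ ⟨$⟩ˡ k)))

module _ {m n} (σ : Permutation m n) where
  sum-rearrange : ∀ (x : Vector ℚ m) → sum (λ k → x (σ ⟨$⟩ˡ k)) ≡ sum x
  sum-rearrange x = trans (ℚ-Sum.sum-permute (λ k → x (σ ⟨$⟩ˡ k)) σ)
    (ℚ-Sum.sum-cong-≗ {x = λ i → x (σ ⟨$⟩ˡ (σ ⟨$⟩ʳ i))} (λ i → cong x (Perm.inverseˡ σ {i})))

  comb-rearrange : ∀ {d} (W : Vector (LatticePoint d) n) (x : Vector ℚ m) →
    comb (λ k → x (σ ⟨$⟩ˡ k)) W ≗ comb x (λ i → W (σ ⟨$⟩ʳ i))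
  comb-rearrange W x j = trans
    (ℚ-Sum.sum-permute (λ k → x (σ ⟨$⟩ˡ k) * fromℤ (W k j)) σ)
    (ℚ-Sum.sum-cong-≗ (λ i → cong (λ l → x l * fromℤ (W (σ ⟨$⟩ʳ i) j)) (Perm.inverseˡ σ)))

  independent-rearrange : ∀ {d} {W : Vector (LatticePoint d) n} →
    AffinelyIndependent W → AffinelyIndependent (λ i → W (σ ⟨$⟩ʳ i))
  independent-rearrange {W = W} ind a sum-a comb-a i = trans
    (cong a (sym (Perm.inverseˡ σ)))
    (ind (λ k → a (σ ⟨$⟩ˡ k)) (trans (sum-rearrange a) sum-a)
      (λ j → trans (comb-rearrange W a j) (comb-a j)) (σ ⟨$⟩ʳ i))

  Lattice-rearrange : ∀ {d} {W : Vector (LatticePoint d) n} {x} →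
    Lattice (λ i → W (σ ⟨$⟩ʳ i)) x ⇔ Lattice W (λ k → x (σ ⟨$⟩ˡ k))
  Lattice-rearrange {W = W} {x} = mk⇔
    (λ (h , s) → (λ j → subst IsInteger (sym (comb-rearrange W x j)) (h j)) ,
                 subst IsInteger (sym (sum-rearrange x)) s)
    (λ (h , s) → (λ j → subst IsInteger (comb-rearrange W x j) (h j)) ,
                 subst IsInteger (sum-rearrange x) s)

  Hull-rearrange : ∀ {d} {W : Vector (LatticePoint d) n} {y} →
    Hull (λ i → W (σ ⟨$⟩ʳ i)) y ⇔ Hull W y
  Hull-rearrange {W = W} = mk⇔
    (λ (μ , μ≥0 , sum-μ , y≡) → (λ k → μ (σ ⟨$⟩ˡ k)) , (λ k → μ≥0 (σ ⟨$⟩ˡ k)) ,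
       trans (sum-rearrange μ) sum-μ , λ j → trans (y≡ j) (sym (comb-rearrange W μ j)))
    (λ (μ , μ≥0 , sum-μ , y≡) → (λ i → μ (σ ⟨$⟩ʳ i)) , (λ i → μ≥0 (σ ⟨$⟩ʳ i)) ,
       trans (sym (ℚ-Sum.sum-permute μ σ)) sum-μ ,
       λ j → trans (y≡ j) (ℚ-Sum.sum-permute (λ k → μ k * fromℤ (W k j)) σ))

linear-integer : ∀ {d e} (A : Fin e → Fin d → ℤ) {x : Point d} →
  (∀ j → IsInteger (x j)) → ∀ i → IsInteger (linear A x i)
linear-integer A {x} h i = int-sum (λ j → fromℤ (A i j) * x j) (λ j → int-* (A i j , refl) (h j))

module _ {d e} (φ : AffineUnimodular d e) where
  open AffineUnimodular φ

  apply-cong : ∀ {x y} → x ≗ y → apply x ≗ apply y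
  apply-cong eq i = cong (_+ fromℤ (translation i)) (linear-cong matrix eq i)

  apply-injective : ∀ {x y} → apply x ≗ apply y → x ≗ y
  apply-injective {x} {y} eq i = begin
    x i                              ≡⟨ linear-inverse matrix inverse inverseˡ x i ⟨
    linear inverse (linear matrix x) i
      ≡⟨ linear-cong inverse {linear matrix x} {linear matrix y}
           (λ k → +-cancelʳ (fromℤ (translation k)) (linear matrix x k) (linear matrix y k) (eq k)) i ⟩
    linear inverse (linear matrix y) i  ≡⟨ linear-inverse matrix inverse inverseˡ y i ⟩
    y i                              ∎
    where open ≡-Reasoning

  apply-combination : ∀ {n} (μ : Vector ℚ n) (p : Fin n → Point d) → sum μ ≡ 1ℚ →
    ∀ i → ∑[ k < n ] (μ k * apply (p k) i) ≡ apply (λ j → ∑[ k < n ] (μ k * p k j)) i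
  apply-combination μ p sum-μ i = trans (∑-affine matrix translation μ p i)
    (cong (λ u → linear matrix (λ j → ∑[ k < _ ] (μ k * p k j)) i + u)
      (trans (cong (_* fromℤ (translation i)) sum-μ) (ℚ.*-identityˡ (fromℤ (translation i)))))

module _ {n d e} {V : Vector (LatticePoint d) n} {W : Vector (LatticePoint e) n} where

  AffineMap⇒Lattice⊆ : AffineMap V W → ∀ {x} → Lattice V x → Lattice W x
  AffineMap⇒Lattice⊆ f {x} (h , s) =
    (λ i → subst IsInteger (sym (comb-image x i))
      (int-+ (linear-integer matrix h i) (int-* s (translation i , refl)))) , s
    where open AffineMap f

  unimodular⇒Lattice⇔ : (φ : AffineUnimodular d e) →
    (∀ k → AffineUnimodular.apply φ (fromℤ ∘ V k) ≗ fromℤ ∘ W k) →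
    ∀ x → Lattice V x ⇔ Lattice W x
  unimodular⇒Lattice⇔ φ eq x = mk⇔ (AffineMap⇒Lattice⊆ f) λ (h , s) →
    (λ j → subst IsInteger (linear-inverse matrix inverse inverseˡ (comb x V) j)
      (linear-integer inverse (λ i → subst IsInteger (cancel i)
        (int-+ (h i) (int-neg (int-* s (translation i , refl))))) j)) , s
    where
    open AffineUnimodular φ
    open ℚSolver.+-*-Solver
    f : AffineMap V W
    f = record { matrix = matrix ; translation = translation ; maps = eq }
    cancel : ∀ i → comb x W i + - (sum x * fromℤ (translation i)) ≡ linear matrix (comb x V) i
    cancel i = trans (cong (_+ - (sum x * fromℤ (translation i))) (AffineMap.comb-image f x i))
      (solve 2 (λ p q → p :+ q :+ :- q := p) refl (linear matrix (comb x V) i) (sum x * fromℤ (translation i)))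

  Lattice⇔⇒isomorphic : AffinelyIndependent V → AffinelyIndependent W → n ≡ suc d → n ≡ suc e →
    (∀ x → Lattice V x ⇔ Lattice W x) → Hull V ≅ᴾ Hull W
  Lattice⇔⇒isomorphic indV indW n≡1+d n≡1+e same = φ , λ y → mk⇔
    (λ (μ , μ≥0 , sum-μ , y≡) → comb μ V , (μ , μ≥0 , sum-μ , λ _ → refl) ,
       λ i → trans (y≡ i) (image μ sum-μ i))
    (λ (x , (μ , μ≥0 , sum-μ , x≡) , y≡) → μ , μ≥0 , sum-μ ,
       λ i → trans (y≡ i) (trans (apply-cong φ x≡ i) (sym (image μ sum-μ i))))
    where
    f : AffineMap V W
    f = Frame.affineMap indV n≡1+d W (λ x → to (same x))
    g : AffineMap W V
    g = Frame.affineMap indW n≡1+e V (λ x → from (same x))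
    φ : AffineUnimodular d e
    φ = record
      { matrix      = AffineMap.matrix f
      ; inverse     = AffineMap.matrix g
      ; translation = AffineMap.translation f
      ; inverseˡ    = Frame.product-identity indV n≡1+d f g
      ; inverseʳ    = Frame.product-identity indW n≡1+e g f
      }
    image : ∀ μ → sum μ ≡ 1ℚ → comb μ W ≗ AffineUnimodular.apply φ (comb μ V)
    image μ sum-μ i = trans (AffineMap.comb-image f μ i)
      (cong (λ u → linear (AffineMap.matrix f) (comb μ V) i + u)
        (trans (cong (_* fromℤ (AffineMap.translation f i)) sum-μ)
          (ℚ.*-identityˡ (fromℤ (AffineMap.translation f i)))))

module _ {m n d e} {V : Vector (LatticePoint d) m} {W : Vector (LatticePoint e) n}
         (indV : AffinelyIndependent V) (indW : AffinelyIndependent W) where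

  module VertexMatching (φ : AffineUnimodular d e)
    (image : ∀ y → Hull W y ⇔ (∃[ x ] Hull V x × y ≗ AffineUnimodular.apply φ x)) where
    open AffineUnimodular φ
    open ≡-Reasoning

    image-of-vertex : ∀ i → Hull W (apply (fromℤ ∘ V i))
    image-of-vertex i = from (image _) (fromℤ ∘ V i , vertex∈Hull V i (λ _ → refl) , λ _ → refl)

    preimage-of-vertex : ∀ k → ∃[ x ] Hull V x × fromℤ ∘ W k ≗ apply x
    preimage-of-vertex k = to (image _) (vertex∈Hull W k (λ _ → refl))

    M : Fin m → Fin n → ℚ
    M i = proj₁ (image-of-vertex i)

    M≥0 : ∀ i k → 0ℚ ℚ.≤ M i k
    M≥0 i = proj₁ (proj₂ (image-of-vertex i))

    sum-M : ∀ i → sum (M i) ≡ 1ℚ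
    sum-M i = proj₁ (proj₂ (proj₂ (image-of-vertex i)))

    apply-V : ∀ i → apply (fromℤ ∘ V i) ≗ comb (M i) W
    apply-V i = proj₂ (proj₂ (proj₂ (image-of-vertex i)))

    B : Fin n → Fin m → ℚ
    B k = proj₁ (proj₁ (proj₂ (preimage-of-vertex k)))

    B≥0 : ∀ k i → 0ℚ ℚ.≤ B k i
    B≥0 k = proj₁ (proj₂ (proj₁ (proj₂ (preimage-of-vertex k))))

    sum-B : ∀ k → sum (B k) ≡ 1ℚ
    sum-B k = proj₁ (proj₂ (proj₂ (proj₁ (proj₂ (preimage-of-vertex k)))))

    W-apply : ∀ k → fromℤ ∘ W k ≗ apply (comb (B k) V)
    W-apply k j = trans (proj₂ (proj₂ (preimage-of-vertex k)) j)
      (apply-cong φ (proj₂ (proj₂ (proj₂ (proj₁ (proj₂ (preimage-of-vertex k)))))) j)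

    MB≡I : ∀ i i′ → ∑[ k < n ] (M i k * B k i′) ≡ unit i i′
    MB≡I i = comb-injective indV (λ i′ → ∑[ k < n ] (M i k * B k i′)) (unit i)
      (trans (stochastic-product M B sum-M sum-B i) (sym (sum-unit i)))
      (λ j → trans (sym (∑-*-assoc (M i) B (λ l → fromℤ (V l j))))
        (trans (sym (apply-injective φ {fromℤ ∘ V i} {λ j → ∑[ k < n ] (M i k * comb (B k) V j)} step j))
          (sym (comb-unit V i j))))
      where
      step : apply (fromℤ ∘ V i) ≗ apply (λ j → ∑[ k < n ] (M i k * comb (B k) V j))
      step j = begin
        apply (fromℤ ∘ V i) j                           ≡⟨ apply-V i j ⟩
        comb (M i) W j                                  ≡⟨ ℚ-Sum.sum-cong-≗ (λ k → cong (M i k *_) (W-apply k j)) ⟩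
        ∑[ k < n ] (M i k * apply (comb (B k) V) j)     ≡⟨ apply-combination φ (M i) (λ k → comb (B k) V) (sum-M i) j ⟩
        apply (λ j → ∑[ k < n ] (M i k * comb (B k) V j)) j ∎

    BM≡I : ∀ k k′ → ∑[ i < m ] (B k i * M i k′) ≡ unit k k′
    BM≡I k = comb-injective indW (λ k′ → ∑[ i < m ] (B k i * M i k′)) (unit k)
      (trans (stochastic-product B M sum-B sum-M k) (sym (sum-unit k)))
      (λ j → begin
        comb (λ k′ → ∑[ i < m ] (B k i * M i k′)) W j   ≡⟨ ∑-*-assoc (B k) M (λ l → fromℤ (W l j)) ⟨
        ∑[ i < m ] (B k i * comb (M i) W j)             ≡⟨ ℚ-Sum.sum-cong-≗ (λ i → cong (B k i *_) (sym (apply-V i j))) ⟩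
        ∑[ i < m ] (B k i * apply (fromℤ ∘ V i) j)      ≡⟨ apply-combination φ (B k) (λ i → fromℤ ∘ V i) (sum-B k) j ⟩
        apply (comb (B k) V) j                          ≡⟨ W-apply k j ⟨
        fromℤ (W k j)                                   ≡⟨ comb-unit W k j ⟨
        comb (unit k) W j                               ∎)

    forward : ∀ i → ∃[ k ] apply (fromℤ ∘ V i) ≗ fromℤ ∘ W k
    forward i = let k , eq = stochastic-inverse M B M≥0 B≥0 sum-M sum-B MB≡I i in
      k , λ j → sym (trans (W-apply k j)
        (apply-cong φ (λ l → trans (comb-cong V eq l) (comb-unit V i l)) j))

    backward : ∀ k → ∃[ i ] apply (fromℤ ∘ V i) ≗ fromℤ ∘ W k
    backward k = let i , eq = stochastic-inverse B M B≥0 M≥0 sum-B sum-M BM≡I k in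
      i , λ j → trans (apply-V i j) (trans (comb-cong W eq j) (comb-unit W k j))

    matching : Permutation m n
    matching = permutation (proj₁ ∘ forward) (proj₁ ∘ backward)
      (λ k → vertex-injective indW (λ j → fromℤ-injective
        (trans (sym (proj₂ (forward (proj₁ (backward k))) j)) (proj₂ (backward k) j))))
      (λ i → vertex-injective indV (λ j → fromℤ-injective
        (apply-injective φ {fromℤ ∘ V (proj₁ (backward (proj₁ (forward i))))} {fromℤ ∘ V i}
          (λ l → trans (proj₂ (backward (proj₁ (forward i))) l)
          (sym (proj₂ (forward i) l))) j)))

  isomorphic⇔Lattice⇔ : m ≡ suc d → n ≡ suc e →
    Hull V ≅ᴾ Hull W ⇔ LatticeIsomorphic V W
  isomorphic⇔Lattice⇔ m≡1+d n≡1+e = mk⇔ forth back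
    where
    forth : Hull V ≅ᴾ Hull W → LatticeIsomorphic V W
    forth (φ , image) = matching , λ x → mk⇔
        (to (Lattice-rearrange matching {W = W} {x}) ∘ to (same x))
        (from (same x) ∘ from (Lattice-rearrange matching {W = W} {x}))
      where
      open VertexMatching φ image
      same = unimodular⇒Lattice⇔ φ (proj₂ ∘ forward)
    back : LatticeIsomorphic V W → Hull V ≅ᴾ Hull W
    back (σ , same) = φ , λ y → mk⇔
        (to (image y) ∘ from (Hull-rearrange σ {W = W} {y}))
        (to (Hull-rearrange σ {W = W} {y}) ∘ from (image y))
      where
      iso = Lattice⇔⇒isomorphic indV (independent-rearrange σ indW) m≡1+d (trans (Perm.↔⇒≡ σ) n≡1+e)
        (λ x → mk⇔ (from (Lattice-rearrange σ {W = W} {x}) ∘ to (same x))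
                   (from (same x) ∘ to (Lattice-rearrange σ {W = W} {x})))
      φ = proj₁ iso
      image = proj₂ iso

-- The free join

↑-elim : ∀ {m n} {P : Fin (m ℕ.+ n) → Set} →
  (∀ i → P (i ↑ˡ n)) → (∀ j → P (m ↑ʳ j)) → ∀ k → P k
↑-elim {m} {n} {P} f g k = subst P (Fin.join-splitAt m n k) (cases (splitAt m k))
  where
  cases : ∀ s → P (join m n s)
  cases (inj₁ i) = f i
  cases (inj₂ j) = g j

sum-↑ : ∀ m {n} (f : Vector ℚ (m ℕ.+ n)) → sum f ≡ sum (λ i → f (i ↑ˡ n)) + sum (λ j → f (m ↑ʳ j))
sum-↑ zero    f = sym (ℚ.+-identityˡ (sum f))
sum-↑ (suc m) f = trans (cong (λ u → f zero + u) (sum-↑ m (f ∘ suc)))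
  (sym (ℚ.+-assoc (f zero) _ _))

module JoinCoordinates (d₁ d₂ : ℕ) where
  inBottom : Fin d₁ → Fin (d₁ ℕ.+ d₂ ℕ.+ 1)
  inBottom j = (j ↑ˡ d₂) ↑ˡ 1

  inTop : Fin d₂ → Fin (d₁ ℕ.+ d₂ ℕ.+ 1)
  inTop j = (d₁ ↑ʳ j) ↑ˡ 1

  height : Fin (d₁ ℕ.+ d₂ ℕ.+ 1)
  height = (d₁ ℕ.+ d₂) ↑ʳ zero

  coordinate-elim : {P : Fin (d₁ ℕ.+ d₂ ℕ.+ 1) → Set} →
    (∀ j → P (inBottom j)) → (∀ j → P (inTop j)) → P height → ∀ c → P c
  coordinate-elim b t h = ↑-elim (↑-elim b t) (λ { zero → h })

  module _ {A : Set} (p : Vector A d₁) (q : Vector A d₂) (h : Vector A 1) where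
    at-bottom : ∀ j → ((p ++ q) ++ h) (inBottom j) ≡ p j
    at-bottom j = trans (lookup-++ˡ (p ++ q) h (j ↑ˡ d₂)) (lookup-++ˡ p q j)

    at-top : ∀ j → ((p ++ q) ++ h) (inTop j) ≡ q j
    at-top j = trans (lookup-++ˡ (p ++ q) h (d₁ ↑ʳ j)) (lookup-++ʳ p q j)

    at-height : ((p ++ q) ++ h) height ≡ h zero
    at-height = lookup-++ʳ (p ++ q) h zero

module _ {n₁ n₂ d₁ d₂} (V₁ : Vector (LatticePoint d₁) n₁) (V₂ : Vector (LatticePoint d₂) n₂) where
  open JoinCoordinates d₁ d₂

  joinVertex : Vector (LatticePoint (d₁ ℕ.+ d₂ ℕ.+ 1)) (n₁ ℕ.+ n₂)
  joinVertex = (λ i → (V₁ i ++ replicate d₂ 0ℤ) ++ replicate 1 0ℤ)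
            ++ (λ i → (replicate d₁ 0ℤ ++ V₂ i) ++ replicate 1 1ℤ)

  joinVertexˡ : ∀ i → joinVertex (i ↑ˡ n₂) ≡ (V₁ i ++ replicate d₂ 0ℤ) ++ replicate 1 0ℤ
  joinVertexˡ = lookup-++ˡ _ _

  joinVertexʳ : ∀ i → joinVertex (n₁ ↑ʳ i) ≡ (replicate d₁ 0ℤ ++ V₂ i) ++ replicate 1 1ℤ
  joinVertexʳ = lookup-++ʳ {m = n₁} _ _

  module _ (a : Vector ℚ (n₁ ℕ.+ n₂)) where
    left : Vector ℚ n₁
    left i = a (i ↑ˡ n₂)

    right : Vector ℚ n₂
    right i = a (n₁ ↑ʳ i)

    comb-join : ∀ c (f : Vector ℤ n₁) (g : Vector ℤ n₂) →
      (∀ i → joinVertex (i ↑ˡ n₂) c ≡ f i) → (∀ i → joinVertex (n₁ ↑ʳ i) c ≡ g i) →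
      comb a joinVertex c ≡ ∑[ i < n₁ ] (left i * fromℤ (f i)) + ∑[ i < n₂ ] (right i * fromℤ (g i))
    comb-join c f g f≡ g≡ = trans (sum-↑ n₁ (λ i → a i * fromℤ (joinVertex i c)))
      (cong₂ _+_ (ℚ-Sum.sum-cong-≗ (λ i → cong (λ z → left i * fromℤ z) (f≡ i)))
                 (ℚ-Sum.sum-cong-≗ (λ i → cong (λ z → right i * fromℤ z) (g≡ i))))

    comb-bottom : ∀ j → comb a joinVertex (inBottom j) ≡ comb left V₁ j
    comb-bottom j = trans
      (comb-join (inBottom j) (λ i → V₁ i j) (λ _ → 0ℤ)
        (λ i → trans (cong-app (joinVertexˡ i) _) (at-bottom (V₁ i) _ _ j))
        (λ i → trans (cong-app (joinVertexʳ i) _) (at-bottom (replicate d₁ 0ℤ) _ _ j)))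
      (trans (cong (λ u → comb left V₁ j + u) (sum-zero (λ i → right i * 0ℚ) (ℚ.*-zeroʳ ∘ right)))
        (ℚ.+-identityʳ (comb left V₁ j)))

    comb-top : ∀ j → comb a joinVertex (inTop j) ≡ comb right V₂ j
    comb-top j = trans
      (comb-join (inTop j) (λ _ → 0ℤ) (λ i → V₂ i j)
        (λ i → trans (cong-app (joinVertexˡ i) _) (at-top (V₁ i) (replicate d₂ 0ℤ) _ j))
        (λ i → trans (cong-app (joinVertexʳ i) _) (at-top (replicate d₁ 0ℤ) (V₂ i) _ j)))
      (trans (cong (_+ comb right V₂ j) (sum-zero (λ i → left i * 0ℚ) (ℚ.*-zeroʳ ∘ left)))
        (ℚ.+-identityˡ (comb right V₂ j)))

    comb-height : comb a joinVertex height ≡ sum right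
    comb-height = trans
      (comb-join height (λ _ → 0ℤ) (λ _ → 1ℤ)
        (λ i → trans (cong-app (joinVertexˡ i) _) (at-height (V₁ i) (replicate d₂ 0ℤ) _))
        (λ i → trans (cong-app (joinVertexʳ i) _) (at-height (replicate d₁ 0ℤ) (V₂ i) _)))
      (trans (cong₂ _+_ (sum-zero (λ i → left i * 0ℚ) (ℚ.*-zeroʳ ∘ left)) (∑-*-1 right))
        (ℚ.+-identityˡ (sum right)))

  join-independent : AffinelyIndependent V₁ → AffinelyIndependent V₂ → AffinelyIndependent joinVertex
  join-independent ind₁ ind₂ a sum-a comb-a = ↑-elim
    (ind₁ (left a) sum-left (λ j → trans (sym (comb-bottom a j)) (comb-a (inBottom j))))
    (ind₂ (right a) sum-right (λ j → trans (sym (comb-top a j)) (comb-a (inTop j))))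
    where
    sum-right : sum (right a) ≡ 0ℚ
    sum-right = trans (sym (comb-height a)) (comb-a height)
    sum-left : sum (left a) ≡ 0ℚ
    sum-left = trans (sym (ℚ.+-identityʳ (sum (left a))))
      (trans (cong (λ u → sum (left a) + u) (sym sum-right)) (trans (sym (sum-↑ n₁ a)) sum-a))

  Lattice-join : ∀ x → Lattice joinVertex x ⇔ (Lattice V₁ (left x) × Lattice V₂ (right x))
  Lattice-join x = mk⇔
    (λ (h , s) → let s₂ = subst IsInteger (comb-height x) (h height) in
      ((λ j → subst IsInteger (comb-bottom x j) (h (inBottom j))) ,
        subst IsInteger cancel (int-+ s (int-neg s₂))) ,
      ((λ j → subst IsInteger (comb-top x j) (h (inTop j))) , s₂))
    (λ ((h₁ , s₁) , (h₂ , s₂)) →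
      coordinate-elim (λ j → subst IsInteger (sym (comb-bottom x j)) (h₁ j))
                      (λ j → subst IsInteger (sym (comb-top x j)) (h₂ j))
                      (subst IsInteger (sym (comb-height x)) s₂) ,
      subst IsInteger (sym (sum-↑ n₁ x)) (int-+ s₁ s₂))
    where
    open ℚSolver.+-*-Solver
    cancel : sum x + - sum (right x) ≡ sum (left x)
    cancel = trans (cong (_+ - sum (right x)) (sum-↑ n₁ x))
      (solve 2 (λ p q → p :+ q :+ :- q := p) refl (sum (left x)) (sum (right x)))

  Hull-bottom : ∀ {p z} → Hull V₁ p → z ≗ ((p ++ replicate d₂ 0ℚ) ++ replicate 1 0ℚ) → Hull joinVertex z
  Hull-bottom {p} {z} (μ , μ≥0 , sum-μ , p≡) z≡ = ν ,
    ↑-elim (λ i → subst (0ℚ ℚ.≤_) (sym (νˡ i)) (μ≥0 i)) (λ i → ℚ.≤-reflexive (sym (νʳ i))) ,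
    trans (sum-↑ n₁ ν) (trans (cong₂ _+_ (trans (ℚ-Sum.sum-cong-≗ νˡ) sum-μ) sum-νʳ) (ℚ.+-identityʳ 1ℚ)) ,
    coordinate-elim
      (λ j → trans (z≡ _) (trans (at-bottom p _ _ j) (trans (p≡ j)
        (sym (trans (comb-bottom ν j) (comb-cong V₁ νˡ j))))))
      (λ j → trans (z≡ _) (trans (at-top p (replicate d₂ 0ℚ) _ j)
        (sym (trans (comb-top ν j) (sum-zero (λ i → right ν i * fromℤ (V₂ i j))
          (λ i → trans (cong (_* fromℤ (V₂ i j)) (νʳ i)) (ℚ.*-zeroˡ (fromℤ (V₂ i j)))))))))
      (trans (z≡ _) (trans (at-height p (replicate d₂ 0ℚ) _) (sym (trans (comb-height ν) sum-νʳ))))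
    where
    ν : Vector ℚ (n₁ ℕ.+ n₂)
    ν = μ ++ replicate n₂ 0ℚ
    νˡ : ∀ i → left ν i ≡ μ i
    νˡ = lookup-++ˡ μ _
    νʳ : ∀ i → right ν i ≡ 0ℚ
    νʳ = lookup-++ʳ μ _
    sum-νʳ : sum (right ν) ≡ 0ℚ
    sum-νʳ = sum-zero (right ν) νʳ

  Hull-top : ∀ {q z} → Hull V₂ q → z ≗ ((replicate d₁ 0ℚ ++ q) ++ replicate 1 1ℚ) → Hull joinVertex z
  Hull-top {q} {z} (μ , μ≥0 , sum-μ , q≡) z≡ = ν ,
    ↑-elim (λ i → ℚ.≤-reflexive (sym (νˡ i))) (λ i → subst (0ℚ ℚ.≤_) (sym (νʳ i)) (μ≥0 i)) ,
    trans (sum-↑ n₁ ν) (trans (cong₂ _+_ (sum-zero (left ν) νˡ) sum-νʳ) (ℚ.+-identityˡ 1ℚ)) ,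
    coordinate-elim
      (λ j → trans (z≡ _) (trans (at-bottom (replicate d₁ 0ℚ) q _ j)
        (sym (trans (comb-bottom ν j) (sum-zero (λ i → left ν i * fromℤ (V₁ i j))
          (λ i → trans (cong (_* fromℤ (V₁ i j)) (νˡ i)) (ℚ.*-zeroˡ (fromℤ (V₁ i j)))))))))
      (λ j → trans (z≡ _) (trans (at-top (replicate d₁ 0ℚ) q _ j) (trans (q≡ j)
        (sym (trans (comb-top ν j) (comb-cong V₂ νʳ j))))))
      (trans (z≡ _) (trans (at-height (replicate d₁ 0ℚ) q _) (sym (trans (comb-height ν) sum-νʳ))))
    where
    ν : Vector ℚ (n₁ ℕ.+ n₂)
    ν = replicate n₁ 0ℚ ++ μ
    νˡ : ∀ i → left ν i ≡ 0ℚ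
    νˡ = lookup-++ˡ (replicate n₁ 0ℚ) μ
    νʳ : ∀ i → right ν i ≡ μ i
    νʳ = lookup-++ʳ (replicate n₁ 0ℚ) μ
    sum-νʳ : sum (right ν) ≡ 1ℚ
    sum-νʳ = trans (ℚ-Sum.sum-cong-≗ νʳ) sum-μ

  fromℤ-joinVertexˡ : ∀ i → fromℤ ∘ joinVertex (i ↑ˡ n₂) ≗ ((fromℤ ∘ V₁ i) ++ replicate d₂ 0ℚ) ++ replicate 1 0ℚ
  fromℤ-joinVertexˡ i c = trans (cong (λ f → fromℤ (f c)) (joinVertexˡ i)) (coordinate-elim
    {P = λ c → fromℤ (((V₁ i ++ replicate d₂ 0ℤ) ++ replicate 1 0ℤ) c) ≡
               (((fromℤ ∘ V₁ i) ++ replicate d₂ 0ℚ) ++ replicate 1 0ℚ) c}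
    (λ j → trans (cong fromℤ (at-bottom (V₁ i) _ _ j)) (sym (at-bottom (fromℤ ∘ V₁ i) _ _ j)))
    (λ j → trans (cong fromℤ (at-top (V₁ i) (replicate d₂ 0ℤ) _ j))
      (sym (at-top (fromℤ ∘ V₁ i) (replicate d₂ 0ℚ) _ j)))
    (trans (cong fromℤ (at-height (V₁ i) (replicate d₂ 0ℤ) _))
      (sym (at-height (fromℤ ∘ V₁ i) (replicate d₂ 0ℚ) _))) c)

  fromℤ-joinVertexʳ : ∀ i → fromℤ ∘ joinVertex (n₁ ↑ʳ i) ≗ (replicate d₁ 0ℚ ++ (fromℤ ∘ V₂ i)) ++ replicate 1 1ℚ
  fromℤ-joinVertexʳ i c = trans (cong (λ f → fromℤ (f c)) (joinVertexʳ i)) (coordinate-elim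
    {P = λ c → fromℤ (((replicate d₁ 0ℤ ++ V₂ i) ++ replicate 1 1ℤ) c) ≡
               ((replicate d₁ 0ℚ ++ (fromℤ ∘ V₂ i)) ++ replicate 1 1ℚ) c}
    (λ j → trans (cong fromℤ (at-bottom (replicate d₁ 0ℤ) (V₂ i) _ j))
      (sym (at-bottom (replicate d₁ 0ℚ) (fromℤ ∘ V₂ i) _ j)))
    (λ j → trans (cong fromℤ (at-top (replicate d₁ 0ℤ) (V₂ i) _ j))
      (sym (at-top (replicate d₁ 0ℚ) (fromℤ ∘ V₂ i) _ j)))
    (trans (cong fromℤ (at-height (replicate d₁ 0ℤ) (V₂ i) _))
      (sym (at-height (replicate d₁ 0ℚ) (fromℤ ∘ V₂ i) _))) c)

polytope⇔Hull : ∀ {d} (Δ : LatticeSimplex d) {x} → polytope Δ x ⇔ Hull (LatticeSimplex.vertex Δ) x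
polytope⇔Hull Δ = mk⇔
  (λ (_ , p , λs , p∈ , λs≥0 , sum-λs , x≡) →
    Hull-convex V λs p (λ k → vertex∈Hull V (proj₁ (p∈ k)) (proj₂ (p∈ k))) λs≥0 sum-λs x≡)
  (λ (μ , μ≥0 , sum-μ , x≡) →
    _ , (λ i → fromℤ ∘ V i) , μ , (λ i → i , λ _ → refl) , μ≥0 , sum-μ , x≡)
  where V = LatticeSimplex.vertex Δ

module _ {d₁ d₂} (Δ₁ : LatticeSimplex d₁) (Δ₂ : LatticeSimplex d₂) where
  private
    V₁ = LatticeSimplex.vertex Δ₁
    V₂ = LatticeSimplex.vertex Δ₂

  FreeJoin⇔Hull : ∀ {z} → FreeJoin (polytope Δ₁) (polytope Δ₂) z ⇔ Hull (joinVertex V₁ V₂) z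
  FreeJoin⇔Hull = mk⇔
    (λ (_ , p , λs , p∈ , λs≥0 , sum-λs , z≡) →
      Hull-convex (joinVertex V₁ V₂) λs p
        (λ k → case p∈ k of λ where
          (inj₁ (_ , p∈ , p≡)) → Hull-bottom V₁ V₂ (to (polytope⇔Hull Δ₁) p∈) p≡
          (inj₂ (_ , q∈ , q≡)) → Hull-top V₁ V₂ (to (polytope⇔Hull Δ₂) q∈) q≡)
        λs≥0 sum-λs z≡)
    (λ (μ , μ≥0 , sum-μ , z≡) →
      _ , (λ k → fromℤ ∘ joinVertex V₁ V₂ k) , μ ,
      ↑-elim
        (λ i → inj₁ (fromℤ ∘ V₁ i , from (polytope⇔Hull Δ₁) (vertex∈Hull V₁ i (λ _ → refl)) ,
                     fromℤ-joinVertexˡ V₁ V₂ i))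
        (λ i → inj₂ (fromℤ ∘ V₂ i , from (polytope⇔Hull Δ₂) (vertex∈Hull V₂ i (λ _ → refl)) ,
                     fromℤ-joinVertexʳ V₁ V₂ i)) ,
      μ≥0 , sum-μ , z≡)

≅ᴾ-resp : ∀ {d e} {P P′ : Point d → Set} {Q Q′ : Point e → Set} →
  (∀ {x} → P x ⇔ P′ x) → (∀ {y} → Q y ⇔ Q′ y) → P ≅ᴾ Q → P′ ≅ᴾ Q′
≅ᴾ-resp P⇔ Q⇔ (φ , image) = φ , λ y → mk⇔
  (λ q → let x , p , eq = to (image y) (from Q⇔ q) in x , to P⇔ p , eq)
  (λ (x , p , eq) → to Q⇔ (from (image y) (x , from P⇔ p , eq)))

-- Codes

Lattice-resp : ∀ {n d} (V : Vector (LatticePoint d) n) {x y : Vector ℚ n} → x ≗ y → Lattice V x → Lattice V y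
Lattice-resp V x≗y (h , s) =
  (λ j → subst IsInteger (comb-cong V x≗y j) (h j)) , subst IsInteger (ℚ-Sum.sum-cong-≗ x≗y) s

Lattice-shift : ∀ {n d} (V : Vector (LatticePoint d) n) {x : Vector ℚ n} (z : Vector ℤ n) →
  Lattice V x → Lattice V (λ i → x i + fromℤ (z i))
Lattice-shift V {x} z (h , s) =
  (λ j → subst IsInteger (sym (comb-+ j))
    (int-+ (h j) (int-sum (λ i → fromℤ (z i) * fromℤ (V i j)) (λ i → int-* (z i , refl) (V i j , refl))))) ,
  subst IsInteger (sym (ℚ-Sum.∑-distrib-+ x (fromℤ ∘ z)))
    (int-+ s (int-sum (fromℤ ∘ z) (λ i → z i , refl)))
  where
  comb-+ : ∀ j → comb (λ i → x i + fromℤ (z i)) V j ≡ comb x V j + comb (fromℤ ∘ z) V j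
  comb-+ j = trans (ℚ-Sum.sum-cong-≗ (λ i → ℚ.*-distribʳ-+ (fromℤ (V i j)) (x i) (fromℤ (z i))))
    (ℚ-Sum.∑-distrib-+ (λ i → x i * fromℤ (V i j)) (λ i → fromℤ (z i) * fromℤ (V i j)))

Lattice-zero : ∀ {n d} (V : Vector (LatticePoint d) n) {x : Vector ℚ n} → (∀ i → x i ≡ 0ℚ) → Lattice V x
Lattice-zero V {x} x≡0 =
  (λ j → 0ℤ , sum-zero (λ i → x i * fromℤ (V i j))
    (λ i → trans (cong (_* fromℤ (V i j)) (x≡0 i)) (ℚ.*-zeroˡ (fromℤ (V i j))))) ,
  0ℤ , sum-zero x x≡0

Lattice-frac : ∀ {n d} (V : Vector (LatticePoint d) n) (x : Vector ℚ n) → Lattice V x ⇔ Lattice V (frac ∘ x)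
Lattice-frac V x = mk⇔
  (λ h → Lattice-resp V (λ i → cong (λ u → x i + u) (fromℤ-neg (floor (x i))))
    (Lattice-shift V (λ i → ℤ.- floor (x i)) h))
  (λ h → Lattice-resp V (λ i → solve 2 (λ x f → x :+ :- f :+ f := x) refl (x i) (fromℤ (floor (x i))))
    (Lattice-shift V (floor ∘ x) h))
  where open ℚSolver.+-*-Solver

fromℕ : ℕ → ℚ
fromℕ n = fromℤ (ℤ.+ n)

fromℕ-* : ∀ m n → fromℕ (m ℕ.* n) ≡ fromℕ m * fromℕ n
fromℕ-* m n = trans (cong fromℤ (ℤ.pos-* m n)) (fromℤ-* (ℤ.+ m) (ℤ.+ n))

↧*≡↥ : ∀ q → fromℕ (↧ₙ q) * q ≡ fromℤ (↥ q)
↧*≡↥ q@record{} = ℚ.toℚᵘ-injective (ℚᵘ.≃-trans (ℚ.toℚᵘ-homo-* (fromℕ (↧ₙ q)) q)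
  (ℚᵘ.*≡* (trans (ℤ.*-identityʳ (↧ q ℤ.* ↥ q))
    (trans (ℤ.*-comm (↧ q) (↥ q)) (cong (↥ q ℤ.*_) (sym (ℤ.*-identityˡ (↧ q))))))))

↧∣⇒integer : ∀ {N} q → ↧ₙ q ∣ N → IsInteger (fromℕ N * q)
↧∣⇒integer q (divides k refl) = ℤ.+ k ℤ.* ↥ q , (begin
  fromℕ (k ℕ.* ↧ₙ q) * q          ≡⟨ cong (_* q) (fromℕ-* k (↧ₙ q)) ⟩
  fromℕ k * fromℕ (↧ₙ q) * q      ≡⟨ ℚ.*-assoc (fromℕ k) (fromℕ (↧ₙ q)) q ⟩
  fromℕ k * (fromℕ (↧ₙ q) * q)    ≡⟨ cong (fromℕ k *_) (↧*≡↥ q) ⟩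
  fromℕ k * fromℤ (↥ q)           ≡⟨ fromℤ-* (ℤ.+ k) (↥ q) ⟨
  fromℤ (ℤ.+ k ℤ.* ↥ q)           ∎)
  where open ≡-Reasoning

record Residue {N} (a : Fin N) (y : ℚ) : Set where
  constructor residue
  field equation : fromℕ (toℕ a) ≡ fromℕ N * y

open Residue

residue-value : ∀ {N} (a : Fin N) → ∃[ y ] Residue a y
residue-value {suc N} a = Grid.grid N a , residue (sym (Grid.D*grid N a))

residue-exists : ∀ N .{{_ : NonZero N}} y → 0ℚ ℚ.≤ y → y ℚ.< 1ℚ → IsInteger (fromℕ N * y) →
  Σ[ a ∈ Fin N ] Residue a y
residue-exists (suc N) y 0≤y y<1 h = let a , y≡ = Grid.onGrid N y 0≤y y<1 h in
  a , residue (trans (sym (Grid.D*grid N a)) (cong (fromℕ (suc N) *_) (sym y≡)))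

residue-injective : ∀ {N} {a b : Fin N} {y} → Residue a y → Residue b y → a ≡ b
residue-injective ra rb = Fin.toℕ-injective (ℤ.+-injective (fromℤ-injective (trans (equation ra) (sym (equation rb)))))

fromℕ-cancel : ∀ N .{{_ : NonZero N}} {p q} → fromℕ N * p ≡ fromℕ N * q → p ≡ q
fromℕ-cancel (suc N) {p} {q} eq = trans (sym (1/-cancelˡ (fromℕ (suc N)) p))
  (trans (cong (ℚ.1/ fromℕ (suc N) *_) eq) (1/-cancelˡ (fromℕ (suc N)) q))

residue-unique : ∀ {N} {a : Fin N} {x y} → Residue a x → Residue a y → x ≡ y
residue-unique {suc N} rx ry = fromℕ-cancel (suc N) (trans (sym (equation rx)) (equation ry))

residue≥0 : ∀ {N} {a : Fin N} {y} → Residue a y → 0ℚ ℚ.≤ y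
residue≥0 {suc N} {a} {y} r = ℚ.*-cancelˡ-≤-pos (fromℕ (suc N))
  (subst₂ ℚ._≤_ (sym (ℚ.*-zeroʳ (fromℕ (suc N)))) (equation r) (fromℤ-mono-≤ (ℤ.+≤+ ℕ.z≤n)))

residue<1 : ∀ {N} {a : Fin N} {y} → Residue a y → y ℚ.< 1ℚ
residue<1 {suc N} {a} {y} r = ℚ.*-cancelˡ-<-nonNeg (fromℕ (suc N))
  (subst₂ ℚ._<_ (equation r) (sym (ℚ.*-identityʳ (fromℕ (suc N)))) (fromℤ-mono-< (ℤ.+<+ (Fin.toℕ<n a))))

residue-frac : ∀ {N} {a : Fin N} {y} → Residue a y → frac y ≡ y
residue-frac {y = y} r = frac-id y (residue≥0 r) (residue<1 r)

residue-cast : ∀ {M N} (eq : M ≡ N) {a : Fin M} {y} → Residue a y → Residue (cast eq a) y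
residue-cast refl {a} r = residue (trans (cong fromℕ (Fin.toℕ-cast refl a)) (equation r))

residue-scale : ∀ {N} L .{{_ : NonZero L}} .{{_ : NonZero N}} → N ∣ L → {a : Fin N} → ∀ {y} → Residue a y →
  Residue (((L / N) ℕ.* toℕ a) mod L) y
residue-scale {N} L N∣L {a} {y} r = residue (begin
  fromℕ (toℕ ((k ℕ.* toℕ a) mod L))   ≡⟨ cong fromℕ (Fin.toℕ-fromℕ< _) ⟩
  fromℕ ((k ℕ.* toℕ a) % L)           ≡⟨ cong fromℕ (m<n⇒m%n≡m ka<L) ⟩
  fromℕ (k ℕ.* toℕ a)                 ≡⟨ fromℕ-* k (toℕ a) ⟩
  fromℕ k * fromℕ (toℕ a)             ≡⟨ cong (fromℕ k *_) (equation r) ⟩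
  fromℕ k * (fromℕ N * y)             ≡⟨ ℚ.*-assoc (fromℕ k) (fromℕ N) y ⟨
  fromℕ k * fromℕ N * y               ≡⟨ cong (_* y) (fromℕ-* k N) ⟨
  fromℕ (k ℕ.* N) * y                 ≡⟨ cong (λ u → fromℕ u * y) kN≡L ⟩
  fromℕ L * y                         ∎)
  where
  open ≡-Reasoning
  k = L / N
  kN≡L : k ℕ.* N ≡ L
  kN≡L = m/n*n≡m N∣L
  instance
    k≢0 : NonZero k
    k≢0 = ℕ.m*n≢0⇒m≢0 k {{subst NonZero (sym kN≡L) (ℕ.≢-nonZero (ℕ.≢-nonZero⁻¹ L))}}
  ka<L : k ℕ.* toℕ a ℕ.< L
  ka<L = subst (k ℕ.* toℕ a ℕ.<_) kN≡L (ℕ.*-monoʳ-< k (Fin.toℕ<n a))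

module _ {d} (Δ : LatticeSimplex d) where
  open LatticeSimplex Δ

  private
    N : ℕ
    N = Code.modulus (code Δ)
    isLCM : IsLCMOf (Denominators Δ) N
    isLCM = proj₂ (proj₂ (denominatorLCM Δ))

  modulus-nonZero : NonZero N
  modulus-nonZero = proj₁ (proj₂ (denominatorLCM Δ))

  denominator∣modulus : ∀ x → Lattice vertex x → ∀ i → ↧ₙ (frac (x i)) ∣ N
  denominator∣modulus x h i = IsLCMOf.multiple isLCM (x , to (Lattice-frac vertex x) h , i , refl)

  modulus-least : ∀ {m} → (∀ x → Lattice vertex x → ∀ i → ↧ₙ (frac (x i)) ∣ m) → N ∣ m
  modulus-least h = IsLCMOf.least isLCM λ { (x , x∈Λ , i , refl) → h x (from (Lattice-frac vertex x) x∈Λ) i }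

  words⇔Lattice : ∀ {c y} → (∀ i → Residue (c i) (y i)) → Code.words (code Δ) c ⇔ Lattice vertex y
  words⇔Lattice {c} {y} r = mk⇔
    (λ (x , x∈Λ , r′) → Lattice-resp vertex {frac ∘ x} (λ i → residue-unique (residue (r′ i)) (r i)) x∈Λ)
    (λ h → y , to (Lattice-frac vertex y) h ,
           λ i → trans (equation (r i)) (cong (fromℕ N *_) (sym (residue-frac (r i)))))

  residues : ∀ y → (∀ i → 0ℚ ℚ.≤ y i) → (∀ i → y i ℚ.< 1ℚ) → Lattice vertex y →
    Σ[ c ∈ Vector (Fin N) (suc d) ] (∀ i → Residue (c i) (y i))
  residues y 0≤y y<1 h = proj₁ ∘ r , proj₂ ∘ r
    where
    r : ∀ i → Σ[ a ∈ Fin N ] Residue a (y i)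
    r i = residue-exists N {{modulus-nonZero}} (y i) (0≤y i) (y<1 i)
      (↧∣⇒integer (y i) (subst (λ q → ↧ₙ q ∣ N) (frac-id (y i) (0≤y i) (y<1 i))
        (denominator∣modulus y h i)))

module _ {d₁ d₂} (Δ₁ : LatticeSimplex d₁) (Δ₂ : LatticeSimplex d₂) where
  private
    V₁ = LatticeSimplex.vertex Δ₁
    V₂ = LatticeSimplex.vertex Δ₂
    N₁ = Code.modulus (code Δ₁)
    N₂ = Code.modulus (code Δ₂)
    J = joinVertex V₁ V₂
    L = Code.modulus (code Δ₁ ⊕ code Δ₂)

    instance
      N₁≢0 : NonZero N₁
      N₁≢0 = modulus-nonZero Δ₁
      N₂≢0 : NonZero N₂
      N₂≢0 = modulus-nonZero Δ₂
      L≢0 : NonZero L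
      L≢0 = lcm-nonZero N₁ N₂

    N₁∣L : N₁ ∣ L
    N₁∣L = m∣lcm[m,n] N₁ N₂
    N₂∣L : N₂ ∣ L
    N₂∣L = n∣lcm[m,n] N₁ N₂

  join-denominator∣modulus : ∀ x → Lattice J x → ∀ k → ↧ₙ (frac (x k)) ∣ L
  join-denominator∣modulus x h = let h₁ , h₂ = to (Lattice-join V₁ V₂ x) h in ↑-elim
    (λ i → ∣-trans (denominator∣modulus Δ₁ (λ i → x (i ↑ˡ suc d₂)) h₁ i) N₁∣L)
    (λ i → ∣-trans (denominator∣modulus Δ₂ (λ i → x (suc d₁ ↑ʳ i)) h₂ i) N₂∣L)

  join-modulus-least : ∀ {m} → (∀ x → Lattice J x → ∀ k → ↧ₙ (frac (x k)) ∣ m) → L ∣ m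
  join-modulus-least {m} h = lcm-least
    (modulus-least Δ₁ λ x x∈ i → subst (λ q → ↧ₙ (frac q) ∣ m) (lookup-++ˡ x (replicate (suc d₂) 0ℚ) i)
      (h (x ++ replicate _ 0ℚ)
        (from (Lattice-join V₁ V₂ (x ++ replicate (suc d₂) 0ℚ))
          (Lattice-resp V₁ (λ i → sym (lookup-++ˡ x (replicate (suc d₂) 0ℚ) i)) x∈ ,
           Lattice-zero V₂ (lookup-++ʳ x (replicate (suc d₂) 0ℚ))))
        (i ↑ˡ suc d₂)))
    (modulus-least Δ₂ λ x x∈ i → subst (λ q → ↧ₙ (frac q) ∣ m) (lookup-++ʳ (replicate (suc d₁) 0ℚ) x i)
      (h (replicate (suc d₁) 0ℚ ++ x)
        (from (Lattice-join V₁ V₂ (replicate (suc d₁) 0ℚ ++ x))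
          (Lattice-zero V₁ (lookup-++ˡ (replicate (suc d₁) 0ℚ) x) ,
           Lattice-resp V₂ (λ i → sym (lookup-++ʳ (replicate (suc d₁) 0ℚ) x i)) x∈))
        (suc d₁ ↑ʳ i)))

  ⊕-words⇔Lattice : ∀ {c y} → (∀ k → Residue (c k) (y k)) →
    Code.words (code Δ₁ ⊕ code Δ₂) c ⇔ Lattice J y
  ⊕-words⇔Lattice {c} {y} r = mk⇔ forth back
    where
    y₁ = λ i → y (i ↑ˡ suc d₂)
    y₂ = λ i → y (suc d₁ ↑ʳ i)

    forth : Code.words (code Δ₁ ⊕ code Δ₂) c → Lattice J y
    forth (c₁ , c₂ , c₁∈ , c₂∈ , c≗) = from (Lattice-join V₁ V₂ y)
      (to (words⇔Lattice Δ₁ {c₁} r₁) c₁∈ , to (words⇔Lattice Δ₂ {c₂} r₂) c₂∈)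
      where
      r₁ : ∀ i → Residue (c₁ i) (y₁ i)
      r₁ i = let z , rz = residue-value (c₁ i) in
        subst (Residue (c₁ i)) (residue-unique
          (subst (λ a → Residue a z) (sym (trans (c≗ (i ↑ˡ suc d₂)) (lookup-++ˡ (scale (L / N₁) L c₁) _ i)))
            (residue-scale L N₁∣L rz))
          (r (i ↑ˡ suc d₂))) rz
      r₂ : ∀ i → Residue (c₂ i) (y₂ i)
      r₂ i = let z , rz = residue-value (c₂ i) in
        subst (Residue (c₂ i)) (residue-unique
          (subst (λ a → Residue a z) (sym (trans (c≗ (suc d₁ ↑ʳ i)) (lookup-++ʳ (scale (L / N₁) L c₁) _ i)))
            (residue-scale L N₂∣L rz))
          (r (suc d₁ ↑ʳ i))) rz

    back : Lattice J y → Code.words (code Δ₁ ⊕ code Δ₂) c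
    back h = c₁ , c₂ , from (words⇔Lattice Δ₁ r₁) h₁ , from (words⇔Lattice Δ₂ r₂) h₂ , ↑-elim
      (λ i → residue-injective (r (i ↑ˡ suc d₂))
        (subst (λ a → Residue a (y₁ i)) (sym (lookup-++ˡ (scale (L / N₁) L c₁) _ i))
          (residue-scale L N₁∣L (r₁ i))))
      (λ i → residue-injective (r (suc d₁ ↑ʳ i))
        (subst (λ a → Residue a (y₂ i)) (sym (lookup-++ʳ (scale (L / N₁) L c₁) _ i))
          (residue-scale L N₂∣L (r₂ i))))
      where
      h₁ = proj₁ (to (Lattice-join V₁ V₂ y) h)
      h₂ = proj₂ (to (Lattice-join V₁ V₂ y) h)
      residues₁ = residues Δ₁ y₁ (λ i → residue≥0 (r (i ↑ˡ suc d₂))) (λ i → residue<1 (r (i ↑ˡ suc d₂))) h₁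
      residues₂ = residues Δ₂ y₂ (λ i → residue≥0 (r (suc d₁ ↑ʳ i))) (λ i → residue<1 (r (suc d₁ ↑ʳ i))) h₂
      c₁ = proj₁ residues₁
      c₂ = proj₁ residues₂
      r₁ = proj₂ residues₁
      r₂ = proj₂ residues₂

  module _ {d} (Δ : LatticeSimplex d) where
    private
      V = LatticeSimplex.vertex Δ
      N = Code.modulus (code Δ)

    code≅⇔Lattice⇔ : code Δ ≅ᶜ (code Δ₁ ⊕ code Δ₂) ⇔ LatticeIsomorphic V J
    code≅⇔Lattice⇔ = mk⇔ forth back
      where
      forth : code Δ ≅ᶜ (code Δ₁ ⊕ code Δ₂) → LatticeIsomorphic V J
      forth (N≡L , σ , words⇔) = σ , λ x → mk⇔
        (λ h → transfer x (λ i → ↧∣⇒integer (frac (x i)) (denominator∣modulus Δ x h i)) .to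
                 (to (Lattice-frac V x) h))
        (λ h → from (Lattice-frac V x) (transfer x (integral x h) .from h))
        where
        transfer : ∀ x → (∀ i → IsInteger (fromℕ N * frac (x i))) →
          Lattice V (frac ∘ x) ⇔ Lattice J (λ k → x (σ ⟨$⟩ˡ k))
        transfer x int = mk⇔
          (λ h → from (Lattice-frac J (λ k → x (σ ⟨$⟩ˡ k)))
                   (to (⊕-words⇔Lattice r′) (to (words⇔ c) (from (words⇔Lattice Δ r) h))))
          (λ h → to (words⇔Lattice Δ r)
                   (from (words⇔ c) (from (⊕-words⇔Lattice r′) (to (Lattice-frac J (λ k → x (σ ⟨$⟩ˡ k))) h))))
          where
          r₀ : ∀ i → Σ[ a ∈ Fin N ] Residue a (frac (x i))
          r₀ i = residue-exists N {{modulus-nonZero Δ}} (frac (x i)) (0≤frac (x i)) (frac<1 (x i)) (int i)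
          c : Vector (Fin N) (suc d)
          c = proj₁ ∘ r₀
          r : ∀ i → Residue (c i) (frac (x i))
          r = proj₂ ∘ r₀
          r′ : ∀ k → Residue (cast N≡L (c (σ ⟨$⟩ˡ k))) (frac (x (σ ⟨$⟩ˡ k)))
          r′ k = residue-cast N≡L (r (σ ⟨$⟩ˡ k))
        integral : ∀ x → Lattice J (λ k → x (σ ⟨$⟩ˡ k)) → ∀ i → IsInteger (fromℕ N * frac (x i))
        integral x h i = ↧∣⇒integer (frac (x i)) (subst₂ (λ q M → ↧ₙ (frac q) ∣ M)
          (cong x (Perm.inverseˡ σ)) (sym N≡L)
          (join-denominator∣modulus (λ k → x (σ ⟨$⟩ˡ k)) h (σ ⟨$⟩ʳ i)))

      back : LatticeIsomorphic V J → code Δ ≅ᶜ (code Δ₁ ⊕ code Δ₂)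
      back (σ , same) = N≡L , σ , λ c →
        let r : ∀ i → Residue (c i) (proj₁ (residue-value (c i)))
            r i = proj₂ (residue-value (c i))
            r′ : ∀ k → Residue (cast N≡L (c (σ ⟨$⟩ˡ k))) (proj₁ (residue-value (c (σ ⟨$⟩ˡ k))))
            r′ k = residue-cast N≡L (r (σ ⟨$⟩ˡ k))
        in mk⇔ (λ w → from (⊕-words⇔Lattice r′)
                 (to (same (λ i → proj₁ (residue-value (c i)))) (to (words⇔Lattice Δ r) w)))
               (λ w → from (words⇔Lattice Δ r)
                 (from (same (λ i → proj₁ (residue-value (c i)))) (to (⊕-words⇔Lattice r′) w)))
        where
        N∣L : N ∣ L
        N∣L = modulus-least Δ λ x h i → subst (λ q → ↧ₙ (frac q) ∣ L) (cong x (Perm.inverseˡ σ))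
          (join-denominator∣modulus (λ k → x (σ ⟨$⟩ˡ k)) (to (same x) h) (σ ⟨$⟩ʳ i))
        L∣N : L ∣ N
        L∣N = join-modulus-least λ x h k → subst (λ q → ↧ₙ (frac q) ∣ N) (cong x (Perm.inverseʳ σ))
          (denominator∣modulus Δ (λ i → x (σ ⟨$⟩ʳ i))
            (from (same (λ i → x (σ ⟨$⟩ʳ i))) (Lattice-resp J {x} (λ k → cong x (sym (Perm.inverseʳ σ))) h))
            (σ ⟨$⟩ˡ k))
        N≡L : N ≡ L
        N≡L = ∣-antisym N∣L L∣N

lemma2p9 : ∀ {d d₁ d₂} (Δ : LatticeSimplex d) (Δ₁ : LatticeSimplex d₁) (Δ₂ : LatticeSimplex d₂) →
    (polytope Δ ≅ᴾ FreeJoin (polytope Δ₁) (polytope Δ₂)) ⇔ (code Δ ≅ᶜ (code Δ₁ ⊕ code Δ₂))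
lemma2p9 {d} {d₁} {d₂} Δ Δ₁ Δ₂ = mk⇔
  (from (code≅⇔Lattice⇔ Δ₁ Δ₂ Δ) ∘ to hull≅⇔ ∘
   ≅ᴾ-resp (λ {x} → polytope⇔Hull Δ {x}) (λ {y} → FreeJoin⇔Hull Δ₁ Δ₂ {y}))
  (≅ᴾ-resp (λ {x} → ⇔-sym (polytope⇔Hull Δ {x})) (λ {y} → ⇔-sym (FreeJoin⇔Hull Δ₁ Δ₂ {y})) ∘
   from hull≅⇔ ∘ to (code≅⇔Lattice⇔ Δ₁ Δ₂ Δ))
  where
  open LatticeSimplex using (vertex; affinelyIndependent)
  dimension : suc d₁ ℕ.+ suc d₂ ≡ suc (d₁ ℕ.+ d₂ ℕ.+ 1)
  dimension = cong suc (trans (ℕ.+-suc d₁ d₂) (ℕ.+-comm 1 (d₁ ℕ.+ d₂)))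
  hull≅⇔ = isomorphic⇔Lattice⇔ {V = vertex Δ} {joinVertex (vertex Δ₁) (vertex Δ₂)} (affinelyIndependent Δ)
    (join-independent (vertex Δ₁) (vertex Δ₂) (affinelyIndependent Δ₁) (affinelyIndependent Δ₂))
    refl dimension
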